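{- Let $m\ge1$, let $h$ be a positive integer, let $\lambda$ be a partition with at most $m$ parts and let $\mathbf{x}=(x_1,\ldots,x_m)$. Then the Newton polytope $\mathrm{Newt}(G_{h,\lambda}(\mathbf{x}))$ has the integer decomposition property.
   Context: $\mathrm{Newt}(f)$ is the convex hull of exponent vectors of monomials with nonzero coefficient in $f$. The Schur polynomial $s_\mu(x_1,\ldots,x_m)=\sum_T\mathbf{x}^T$ over semistandard Young tableaux $T$ of shape $\mu$ with entries in $\{1,\ldots,m\}$. For a partition $\mu\supseteq\lambda$ with at most $m$ rows, $b_{h,\lambda\mu}$ is the number of fillings of the skew shape $\mu/\lambda$ with positive integers strictly increasing along each row and column, entries in row $r$ from $\{1,\ldots,h(r-1)\}$; $A(h,\lambda)=\{\mu\mid b_{h,\lambda\mu}\neq0\}$; $G_{h,\lambda}(\mathbf{x})=\sum_{\mu\in A(h,\lambda)}(-1)^{|\mu/\lambda|}b_{h,\lambda\mu}s_\mu(\mathbf{x})$. A lattice polytope $\mathcal{P}\subset\mathbb{R}^m$ has the integer decomposition property (IDP) if for every positive integer $t$ and every $\mathbf{p}\in t\mathcal{P}\cap\mathbb{Z}^m$ there exist $\mathbf{v}_1,\ldots,\mathbf{v}_t\in\mathcal{P}\cap\mathbb{Z}^m$ with $\mathbf{p}=\mathbf{v}_1+\cdots+\mathbf{v}_t$.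
   Formalization: The Newton polytope is taken in rational space, as the convex combinations with rational weights of the exponent vectors, instead of in real space; for lattice points of its dilates the two memberships agree. -}

module Defs where

open import Data.Nat as ℕ using (ℕ; zero; suc; _+_; _*_; _∸_; _≤_; _≤ᵇ_; _<ᵇ_; _≡ᵇ_)
open import Data.Bool using (Bool; true; false; _∧_; not; if_then_else_)
open import Data.List as List using (List; []; _∷_; [_]; _++_; map; concatMap; upTo; filterᵇ; length; zip; foldr)
open import Data.List.Relation.Unary.All using (All)
open import Data.Vec as Vec using (Vec; lookup)
open import Data.Fin using (Fin; toℕ)
open import Data.Integer as ℤ using (ℤ; +_; -1ℤ)
open import Data.Rational as ℚ using (ℚ; 0ℚ; 1ℚ)
open import Data.Vec.Relation.Unary.All as VAll using ()
open import Data.Product using (Σ; _×_; _,_; proj₁; proj₂)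
open import Relation.Binary.PropositionalEquality using (_≡_; _≢_)

-- Partitions with at most m parts: weakly decreasing vectors of length m
-- (padded with zeros).  Rows / variables are indexed from 0 in Agda;
-- Agda row r corresponds to row r+1 of the paper.

IsPartition : ∀ {m} → Vec ℕ m → Set
IsPartition {m} v = ∀ (i j : Fin m) → toℕ i ≤ toℕ j → lookup v j ≤ lookup v i

isPartitionᵇ : ∀ {m} → Vec ℕ m → Bool
isPartitionᵇ Vec.[] = true
isPartitionᵇ (a Vec.∷ Vec.[]) = true
isPartitionᵇ (a Vec.∷ b Vec.∷ v) = (b ≤ᵇ a) ∧ isPartitionᵇ (b Vec.∷ v)

containsᵇ : ∀ {m} → Vec ℕ m → Vec ℕ m → Bool
containsᵇ Vec.[] Vec.[] = true
containsᵇ (l Vec.∷ ls) (u Vec.∷ us) = (l ≤ᵇ u) ∧ containsᵇ ls us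

size : ∀ {m} → Vec ℕ m → ℕ
size = Vec.foldr _ _+_ 0

-- Cells of the skew shape mu / la, as (row, column) pairs (0-based).

Cell : Set
Cell = ℕ × ℕ

skewCells : ∀ {m} → Vec ℕ m → Vec ℕ m → List Cell
skewCells = go 0
  where
  go : ∀ {k} → ℕ → Vec ℕ k → Vec ℕ k → List Cell
  go r Vec.[] Vec.[] = []
  go r (l Vec.∷ ls) (u Vec.∷ us) =
    map (λ c → (r , l + c)) (upTo (u ∸ l)) ++ go (suc r) ls us

listsBelow : ℕ → ℕ → List (List ℕ)
listsBelow zero B = [ [] ]
listsBelow (suc n) B = concatMap (λ x → map (x ∷_) (listsBelow n B)) (upTo B)

fillings : List Cell → ℕ → List (List (Cell × ℕ))
fillings cs B = map (zip cs) (listsBelow (length cs) (suc B))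

allᵇ : {A : Set} → (A → Bool) → List A → Bool
allᵇ p = foldr (λ x b → p x ∧ b) true

allPairs : {A : Set} → (A → A → Bool) → List A → Bool
allPairs p xs = allᵇ (λ x → allᵇ (λ y → p x y) xs) xs

implies : Bool → Bool → Bool
implies a b = not a Data.Bool.∨ b

rowStrictᵇ : Cell × ℕ → Cell × ℕ → Bool
rowStrictᵇ ((r , c) , a) ((r' , c') , b) = implies ((r ≡ᵇ r') ∧ (c <ᵇ c')) (a <ᵇ b)

rowWeakᵇ : Cell × ℕ → Cell × ℕ → Bool
rowWeakᵇ ((r , c) , a) ((r' , c') , b) = implies ((r ≡ᵇ r') ∧ (c <ᵇ c')) (a ≤ᵇ b)

colStrictᵇ : Cell × ℕ → Cell × ℕ → Bool
colStrictᵇ ((r , c) , a) ((r' , c') , b) = implies ((c ≡ᵇ c') ∧ (r <ᵇ r')) (a <ᵇ b)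

-- b_{h,la,mu}: number of fillings of mu/la strictly increasing along rows
-- and columns, entries of paper-row r (= Agda row r-1) in {1,...,h(r-1)}.

bEntryOkᵇ : ℕ → Cell × ℕ → Bool
bEntryOkᵇ h ((r , c) , a) = (1 ≤ᵇ a) ∧ (a ≤ᵇ h * r)

bValidᵇ : ℕ → List (Cell × ℕ) → Bool
bValidᵇ h T = allᵇ (bEntryOkᵇ h) T ∧ allPairs rowStrictᵇ T ∧ allPairs colStrictᵇ T

bCoeff : ∀ {m} → ℕ → Vec ℕ m → Vec ℕ m → ℕ
bCoeff {m} h la mu =
  length (filterᵇ (bValidᵇ h) (fillings (skewCells la mu) (h * m)))

countᵇ : {A : Set} → (A → Bool) → List A → ℕ
countᵇ p xs = length (filterᵇ p xs)

eqVecᵇ : ∀ {k} → Vec ℕ k → Vec ℕ k → Bool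
eqVecᵇ Vec.[] Vec.[] = true
eqVecᵇ (a Vec.∷ as) (b Vec.∷ bs) = (a ≡ᵇ b) ∧ eqVecᵇ as bs

content : ∀ m → List (Cell × ℕ) → Vec ℕ m
content m T = Vec.tabulate (λ i → countᵇ (λ e → proj₂ e ≡ᵇ suc (toℕ i)) T)

ssytValidᵇ : ∀ m → List (Cell × ℕ) → Bool
ssytValidᵇ m T =
  allᵇ (λ e → (1 ≤ᵇ proj₂ e) ∧ (proj₂ e ≤ᵇ m)) T
  ∧ allPairs rowWeakᵇ T ∧ allPairs colStrictᵇ T

schurCoeff : ∀ {m} → Vec ℕ m → Vec ℕ m → ℕ
schurCoeff {m} mu α =
  countᵇ (λ T → ssytValidᵇ m T ∧ eqVecᵇ (content m T) α)
         (fillings (skewCells (Vec.replicate m 0) mu) m)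

-- A(h, la): partitions mu ⊇ la with at most m rows and b_{h,la,mu} ≠ 0.
-- Any such mu satisfies mu_r - la_r ≤ h*r (Agda row r), since row r of a
-- valid filling is strictly increasing with entries in {1..h*r}; so we
-- enumerate la_r ≤ mu_r ≤ la_r + h*r and filter.

candidates : ∀ {m} → ℕ → Vec ℕ m → List (Vec ℕ m)
candidates h = go 0
  where
  go : ∀ {k} → ℕ → Vec ℕ k → List (Vec ℕ k)
  go r Vec.[] = [ Vec.[] ]
  go r (l Vec.∷ ls) =
    concatMap (λ d → map ((l + d) Vec.∷_) (go (suc r) ls)) (upTo (suc (h * r)))

Aset : ∀ {m} → ℕ → Vec ℕ m → List (Vec ℕ m)
Aset h la =
  filterᵇ (λ mu → isPartitionᵇ mu ∧ containsᵇ la mu ∧ not (bCoeff h la mu ≡ᵇ 0))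
          (candidates h la)

sumℤ : List ℤ → ℤ
sumℤ = foldr ℤ._+_ (+ 0)

Gcoeff : ∀ {m} → ℕ → Vec ℕ m → Vec ℕ m → ℤ
Gcoeff h la α = sumℤ (map term (Aset h la))
  where
  term : _ → ℤ
  term mu = (-1ℤ ℤ.^ (size mu ∸ size la))
            ℤ.* (+ bCoeff h la mu) ℤ.* (+ schurCoeff mu α)

-- Newton polytope of a polynomial given by its coefficient function
-- (exponent vector ↦ coefficient): convex hull of the exponent vectors
-- with nonzero coefficient, as a subset of ℚ^m.

ℕtoℚ : ℕ → ℚ
ℕtoℚ n = + n ℚ./ 1

ℤtoℚ : ℤ → ℚ
ℤtoℚ z = z ℚ./ 1

zeroVec : ∀ {m} → Vec ℚ m
zeroVec = Vec.replicate _ 0ℚ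

Newt : ∀ {m} → (Vec ℕ m → ℤ) → Vec ℚ m → Set
Newt {m} f q =
  Σ (List (ℚ × Vec ℕ m)) λ ws →
    All (λ wα → (0ℚ ℚ.≤ proj₁ wα) × (f (proj₂ wα) ≢ + 0)) ws
    × foldr ℚ._+_ 0ℚ (map proj₁ ws) ≡ 1ℚ
    × q ≡ foldr (λ wα acc → Vec.zipWith ℚ._+_
                   (Vec.map (λ a → proj₁ wα ℚ.* ℕtoℚ a) (proj₂ wα)) acc)
                zeroVec ws

InDilate : ∀ {m} → (Vec ℚ m → Set) → ℕ → Vec ℚ m → Set
InDilate P t p = Σ _ λ q → P q × p ≡ Vec.map (λ a → ℕtoℚ t ℚ.* a) q

sumVecsℤ : ∀ {m t} → Vec (Vec ℤ m) t → Vec ℤ m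
sumVecsℤ {m} = Vec.foldr _ (Vec.zipWith ℤ._+_) (Vec.replicate m (+ 0))

HasIDP : ∀ {m} → (Vec ℚ m → Set) → Set
HasIDP {m} P =
  ∀ (t : ℕ) → 1 ≤ t → (p : Vec ℤ m) → InDilate P t (Vec.map ℤtoℚ p) →
  Σ (Vec (Vec ℤ m) t) λ vs →
    VAll.All (λ v → P (Vec.map ℤtoℚ v)) vs × sumVecsℤ vs ≡ p

{-# OPTIONS --safe #-}

-- A filling counted by b_{h,λμ} exists iff μ lies in the box λ_r ≤ μ_r ≤ λ_r + h(r-1), and monomials of G
-- of equal degree have equal signs, so the support of G is the union of the supports of the s_μ with μ a
-- partition in that box.  Let u be the largest such partition.  Every exponent α in the support satisfies
-- λ_{m-k+1} + ⋯ + λ_m ≤ α(I) ≤ u_1 + ⋯ + u_k for each set I of k coordinates; a lattice point p of the t-fold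
-- dilate therefore satisfies t times these inequalities.  Filling the rows greedily from tλ towards tu gives
-- a partition ν with tλ ≤ ν ≤ tu that dominates p, hence a Gelfand–Tsetlin pattern with top row ν and
-- content p.  Applying a ↦ ⌊(a+i)/t⌋ to all entries, for i = 0, …, t-1, keeps the interlacing
-- inequalities, moves the top row into the box, and by Hermite's identity splits p into t exponents of G.
module Submission where

open import Defs
open import Algebra.Bundles using (CommutativeMonoid)
import Algebra.Properties.CommutativeSemigroup as CommutativeSemigroup
open import Data.Bool using (Bool; true; false; not; T; _∧_; T?)
open import Data.Bool.Properties using (T-∧)
open import Data.Fin as Fin using (Fin; toℕ)
open import Data.Integer as ℤ using (ℤ; -1ℤ)
import Data.Integer.Properties as ℤ
open import Data.List using (List; []; _∷_; map; foldr; upTo; applyUpTo; _++_; length; filterᵇ; zip)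
open import Data.List.Membership.Propositional using (_∈_; lose; find)
open import Data.List.Membership.Propositional.Properties
open import Data.List.Properties using (filter-++; length-++)
open import Data.List.Relation.Unary.All using (All; []; _∷_)
open import Data.List.Relation.Unary.AllPairs using ([]; _∷_)
open import Data.List.Relation.Unary.Any using (here; there)
open import Data.List.Relation.Unary.Unique.Propositional using (Unique)
import Data.List.Relation.Unary.Unique.Propositional.Properties as Unique
open import Data.Nat as ℕ
open import Data.Nat.DivMod using (_/_; m<n⇒m/n≡0; m/n≡1+[m∸n]/n; m*n/n≡m; m<n*o⇒m/o<n; /-monoˡ-≤)
open import Data.Nat.ListAction using (sum)
open import Data.Nat.Properties as ℕ
open import Data.Product using (Σ; _×_; _,_; proj₁; proj₂; ∃; uncurry)
open import Data.Product.Properties using (≡-dec)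
open import Data.Rational as ℚ using (ℚ; 0ℚ; 1ℚ)
import Data.Rational.Properties as ℚ
open import Data.Rational.Unnormalised as ℚᵘ using (mkℚᵘ; *≡*; *≤*)
import Data.Rational.Unnormalised.Properties as ℚᵘ
open import Data.Sum using (_⊎_; inj₁; inj₂; [_,_]′)
open import Data.Unit using (tt)
open import Data.Vec as Vec using (Vec; []; _∷_; lookup; replicate; tabulate)
open import Data.Vec.Relation.Unary.All as VAll using ([]; _∷_)
open import Function using (_∘_; id)
open import Function.Bundles using (Equivalence)
open import Relation.Binary using (tri<; tri≈; tri>)
open import Relation.Binary.PropositionalEquality
import Relation.Binary.Reasoning.Setoid as ≃-Reasoning
open import Relation.Nullary using (yes; no; ¬_; contradiction)

open CommutativeSemigroup +-commutativeSemigroup using (interchange; xy∙z≈xz∙y; x∙yz≈xz∙y; x∙yz≈y∙xz)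

-- Sums over initial segments

∑ : (ℕ → ℕ) → ℕ → ℕ
∑ f zero = 0
∑ f (suc n) = ∑ f n + f n

∑-cong : ∀ {f g} n → (∀ i → i < n → f i ≡ g i) → ∑ f n ≡ ∑ g n
∑-cong zero eq = refl
∑-cong (suc n) eq = cong₂ _+_ (∑-cong n (λ i i<n → eq i (m<n⇒m<1+n i<n))) (eq n ≤-refl)

∑-mono : ∀ {f g} n → (∀ i → i < n → f i ≤ g i) → ∑ f n ≤ ∑ g n
∑-mono zero le = z≤n
∑-mono (suc n) le = +-mono-≤ (∑-mono n (λ i i<n → le i (m<n⇒m<1+n i<n))) (le n ≤-refl)

∑-0 : ∀ n → ∑ (λ _ → 0) n ≡ 0
∑-0 zero = refl
∑-0 (suc n) = trans (+-identityʳ _) (∑-0 n)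

∑-1 : ∀ n → ∑ (λ _ → 1) n ≡ n
∑-1 zero = refl
∑-1 (suc n) = trans (+-comm _ 1) (cong suc (∑-1 n))

∑-+ : ∀ f g n → ∑ (λ i → f i + g i) n ≡ ∑ f n + ∑ g n
∑-+ f g zero = refl
∑-+ f g (suc n) = trans (cong (_+ (f n + g n)) (∑-+ f g n)) (interchange (∑ f n) (∑ g n) (f n) (g n))

∑-* : ∀ c f n → ∑ (λ i → c * f i) n ≡ c * ∑ f n
∑-* c f zero = sym (*-zeroʳ c)
∑-* c f (suc n) = trans (cong (_+ c * f n) (∑-* c f n)) (sym (*-distribˡ-+ c (∑ f n) (f n)))

∑-head : ∀ f n → ∑ f (suc n) ≡ f 0 + ∑ (f ∘ suc) n
∑-head f zero = sym (+-identityʳ (f 0))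
∑-head f (suc n) = trans (cong (_+ f (suc n)) (∑-head f n)) (+-assoc (f 0) _ _)

∑-swap : ∀ (f : ℕ → ℕ → ℕ) m n → ∑ (λ i → ∑ (f i) n) m ≡ ∑ (λ j → ∑ (λ i → f i j) m) n
∑-swap f zero n = sym (∑-0 n)
∑-swap f (suc m) n = trans (cong (_+ ∑ (f m) n) (∑-swap f m n))
  (sym (∑-+ (λ j → ∑ (λ i → f i j) m) (f m) n))

-- ∑_{k ≤ j < n} f ≤ ∑_{k ≤ j < n} g, with both sides moved so that no subtraction occurs.
∑-segment-mono : ∀ f g → (∀ j → f j ≤ g j) → ∀ {k n} → k ≤′ n → ∑ g k + ∑ f n ≤ ∑ g n + ∑ f k
∑-segment-mono f g f≤g ≤′-refl = ≤-refl
∑-segment-mono f g f≤g {k} (≤′-step {n} k≤n) =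
  subst₂ _≤_ (+-assoc (∑ g k) (∑ f n) (f n)) (xy∙z≈xz∙y (∑ g n) (∑ f k) (g n))
    (+-mono-≤ (∑-segment-mono f g f≤g k≤n) (f≤g n))

-- Weights and cardinalities of coordinate sets

𝟙 : Bool → ℕ
𝟙 false = 0
𝟙 true = 1

weight : (ℕ → Bool) → (ℕ → ℕ) → ℕ → ℕ
weight I α = ∑ (λ i → 𝟙 (I i) * α i)

card : (ℕ → Bool) → ℕ → ℕ
card I = ∑ (𝟙 ∘ I)

𝟙≤1 : ∀ b → 𝟙 b ≤ 1
𝟙≤1 false = z≤n
𝟙≤1 true = ≤-refl

𝟙-not : ∀ b → 𝟙 b + 𝟙 (not b) ≡ 1
𝟙-not false = refl
𝟙-not true = refl

card≤ : ∀ I n → card I n ≤ n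
card≤ I n = subst (card I n ≤_) (∑-1 n) (∑-mono n (λ i _ → 𝟙≤1 (I i)))

weight-not : ∀ I α n → weight I α n + weight (not ∘ I) α n ≡ ∑ α n
weight-not I α n = trans (sym (∑-+ _ _ n)) (∑-cong n (λ i _ →
  trans (sym (*-distribʳ-+ (α i) (𝟙 (I i)) (𝟙 (not (I i)))))
    (trans (cong (_* α i) (𝟙-not (I i))) (*-identityˡ (α i)))))

Antitone : (ℕ → ℕ) → Set
Antitone f = ∀ j → f (suc j) ≤ f j

antitone-≤ : ∀ {f} → Antitone f → ∀ {i j} → i ≤′ j → f j ≤ f i
antitone-≤ anti ≤′-refl = ≤-refl
antitone-≤ anti (≤′-step i≤j) = ≤-trans (anti _) (antitone-≤ anti i≤j)

extend : ℕ → (ℕ → ℕ) → ℕ → ℕ → ℕ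
extend zero f v zero = v
extend zero f v (suc j) = 0
extend (suc m) f v zero = f 0
extend (suc m) f v (suc j) = extend m (f ∘ suc) v j

extend-< : ∀ m f v {j} → j < m → extend m f v j ≡ f j
extend-< (suc m) f v {zero} _ = refl
extend-< (suc m) f v {suc j} (s≤s j<m) = extend-< m (f ∘ suc) v j<m

extend-≡ : ∀ m f v → extend m f v m ≡ v
extend-≡ zero f v = refl
extend-≡ (suc m) f v = extend-≡ m (f ∘ suc) v

extend-> : ∀ m f v {j} → m < j → extend m f v j ≡ 0
extend-> zero f v {suc j} _ = refl
extend-> (suc m) f v {suc j} (s≤s m<j) = extend-> m (f ∘ suc) v m<j

extend-antitone : ∀ m {f v} → Antitone f → (∀ j → suc j ≡ m → v ≤ f j) → Antitone (extend m f v)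
extend-antitone zero anti v≤ j = z≤n
extend-antitone (suc zero) anti v≤ zero = v≤ 0 refl
extend-antitone (suc (suc m)) anti v≤ zero = anti 0
extend-antitone (suc m) anti v≤ (suc j) = extend-antitone m (anti ∘ suc) (λ j eq → v≤ (suc j) (cong suc eq)) j

∑-extend : ∀ m f v {k} → k ≤ m → ∑ (extend m f v) k ≡ ∑ f k
∑-extend m f v {k} k≤m = ∑-cong k (λ i i<k → extend-< m f v (<-≤-trans i<k k≤m))

∑-extend-suc : ∀ m f v → ∑ (extend m f v) (suc m) ≡ ∑ f m + v
∑-extend-suc m f v = cong₂ _+_ (∑-extend m f v ≤-refl) (extend-≡ m f v)

-- Greedy partitions

-- The dominance-largest partition of n lying between lo and hi in the first m rows.
record Greedy (lo hi : ℕ → ℕ) (m n : ℕ) : Set where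
  field
    ν        : ℕ → ℕ
    antitone : Antitone ν
    lower    : ∀ {j} → j < m → lo j ≤ ν j
    upper    : ∀ {j} → j < m → ν j ≤ hi j
    vanish   : ∀ {j} → m ≤ j → ν j ≡ 0
    total    : ∑ ν m ≡ n
    prefix   : ∀ {k} → k ≤ m → ∑ ν k ≡ ∑ hi k ⊎ ∑ ν k + ∑ lo m ≡ n + ∑ lo k

extend-bounded : ∀ {m} {lo hi f : ℕ → ℕ} {v} → (∀ {j} → j < m → lo j ≤ f j × f j ≤ hi j) → lo m ≤ v → v ≤ hi m →
  ∀ {j} → j < suc m → lo j ≤ extend m f v j × extend m f v j ≤ hi j
extend-bounded {m} {lo} {hi} {f} {v} between lo≤v v≤hi {j} j<1+m with m≤n⇒m<n∨m≡n (s≤s⁻¹ j<1+m)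
... | inj₁ j<m rewrite extend-< m f v j<m = between j<m
... | inj₂ refl rewrite extend-≡ m f v = lo≤v , v≤hi

-- At most one row lies strictly between its bounds: the rows before it are filled to `hi`, the rows
-- after it stay at `lo`. The induction decides the last row. If `n` is at most `∑ hi m + lo m`,
-- that row keeps its minimum and the rest goes to the first `m` rows; otherwise these are full and
-- it takes the remainder. The two alternatives of `prefix` say that all rows before `k` are full,
-- or that all rows from `k` on are minimal.
greedy : ∀ m {lo hi n} → Antitone lo → Antitone hi → (∀ {j} → j < m → lo j ≤ hi j) →
  ∑ lo m ≤ n → n ≤ ∑ hi m → Greedy lo hi m n
greedy zero {n = n} _ _ _ _ n≤ = record
  { ν = λ _ → 0
  ; antitone = λ _ → z≤n
  ; lower = λ ()
  ; upper = λ ()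
  ; vanish = λ _ → refl
  ; total = sym (n≤0⇒n≡0 n≤)
  ; prefix = λ { z≤n → inj₁ refl } }
greedy (suc m) {lo} {hi} {n} lo↓ hi↓ lo≤hi lo≤n n≤hi with n ≤? ∑ hi m + lo m
... | yes small = record
  { ν = ν
  ; antitone = extend-antitone m G.antitone
      λ { j refl → ≤-trans (lo↓ j) (G.lower ≤-refl) }
  ; lower = proj₁ ∘ between
  ; upper = proj₂ ∘ between
  ; vanish = extend-> m G.ν (lo m)
  ; total = total
  ; prefix = prefix }
  where
  n′ = n ∸ lo m
  n≡ : n′ + lo m ≡ n
  n≡ = m∸n+n≡m (m+n≤o⇒n≤o (∑ lo m) lo≤n)
  G : Greedy lo hi m n′
  G = greedy m lo↓ hi↓ (λ j<m → lo≤hi (m<n⇒m<1+n j<m))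
    (+-cancelʳ-≤ (lo m) (∑ lo m) n′ (subst (∑ lo m + lo m ≤_) (sym n≡) lo≤n))
    (+-cancelʳ-≤ (lo m) n′ (∑ hi m) (subst (_≤ ∑ hi m + lo m) (sym n≡) small))
  module G = Greedy G
  ν = extend m G.ν (lo m)
  between : ∀ {j} → j < suc m → lo j ≤ ν j × ν j ≤ hi j
  between = extend-bounded {m} {lo} {hi} (λ j<m → G.lower j<m , G.upper j<m) ≤-refl (lo≤hi ≤-refl)
  total : ∑ ν (suc m) ≡ n
  total = trans (∑-extend-suc m G.ν (lo m)) (trans (cong (_+ lo m) G.total) n≡)
  prefix : ∀ {k} → k ≤ suc m → ∑ ν k ≡ ∑ hi k ⊎ ∑ ν k + ∑ lo (suc m) ≡ n + ∑ lo k
  prefix {k} k≤ with m≤n⇒m<n∨m≡n k≤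
  ... | inj₂ refl = inj₂ (cong (_+ ∑ lo (suc m)) total)
  ... | inj₁ (s≤s k≤m) rewrite ∑-extend m G.ν (lo m) k≤m with G.prefix k≤m
  ...   | inj₁ eq = inj₁ eq
  ...   | inj₂ eq = inj₂ (trans (sym (+-assoc (∑ G.ν k) (∑ lo m) (lo m)))
            (trans (cong (_+ lo m) eq) (trans (xy∙z≈xz∙y n′ (∑ lo k) (lo m)) (cong (_+ ∑ lo k) n≡))))
... | no large = record
  { ν = ν
  ; antitone = extend-antitone m hi↓ λ { j refl → ≤-trans v≤hi (hi↓ j) }
  ; lower = proj₁ ∘ between
  ; upper = proj₂ ∘ between
  ; vanish = extend-> m hi v
  ; total = total
  ; prefix = prefix }
  where
  big : ∑ hi m + lo m ≤ n
  big = ≰⇒≥ large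
  v = n ∸ ∑ hi m
  n≡ : ∑ hi m + v ≡ n
  n≡ = m+[n∸m]≡n (m+n≤o⇒m≤o (∑ hi m) big)
  v≤hi : v ≤ hi m
  v≤hi = +-cancelˡ-≤ (∑ hi m) v (hi m) (subst (_≤ ∑ hi m + hi m) (sym n≡) n≤hi)
  lo≤v : lo m ≤ v
  lo≤v = +-cancelˡ-≤ (∑ hi m) (lo m) v (subst (∑ hi m + lo m ≤_) (sym n≡) big)
  ν = extend m hi v
  between : ∀ {j} → j < suc m → lo j ≤ ν j × ν j ≤ hi j
  between = extend-bounded {m} {lo} {hi} (λ j<m → lo≤hi (m<n⇒m<1+n j<m) , ≤-refl) lo≤v v≤hi
  total : ∑ ν (suc m) ≡ n
  total = trans (∑-extend-suc m hi v) n≡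
  prefix : ∀ {k} → k ≤ suc m → ∑ ν k ≡ ∑ hi k ⊎ ∑ ν k + ∑ lo (suc m) ≡ n + ∑ lo k
  prefix k≤ with m≤n⇒m<n∨m≡n k≤
  ... | inj₂ refl = inj₂ (cong (_+ ∑ lo (suc m)) total)
  ... | inj₁ (s≤s k≤m) = inj₁ (∑-extend m hi v k≤m)

-- Gelfand–Tsetlin patterns

-- Row k of a pattern records the shape formed by the entries ≤ k of a semistandard tableau of shape μ
-- and content α.
record GelfandTsetlin (m : ℕ) (μ α : ℕ → ℕ) : Set where
  field
    x         : ℕ → ℕ → ℕ
    zero-row  : ∀ j → x 0 j ≡ 0
    grow      : ∀ k j → x k j ≤ x (suc k) j
    interlace : ∀ k j → x (suc k) (suc j) ≤ x k j
    top       : ∀ j → x m j ≡ μ j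
    content-∑ : ∀ {i} → i < m → ∑ (x (suc i)) m ≡ α i + ∑ (x i) m

  vanish : ∀ {k j} → k ≤ j → x k j ≡ 0
  vanish {zero} {j} _ = zero-row j
  vanish {suc k} {suc j} (s≤s k≤j) = n≤0⇒n≡0 (subst (x (suc k) (suc j) ≤_) (vanish k≤j) (interlace k j))

  -- The easy half of Rado's criterion, by induction over the rows of the pattern. A coordinate
  -- outside `I` only lets the row grow. For one inside `I`, interlacing bounds the parts of row
  -- `n + 1` after position `k` by those of row `n` from position `k` on, so the increase `α n` of
  -- the row sum is paid for by the first `k + 1` parts.
  weight≤rows : ∀ I {n} → n ≤ m → weight I α n ≤ ∑ (x n) (card I n)
  weight≤rows I {zero} _ = z≤n
  weight≤rows I {suc n} n<m with weight≤rows I (<⇒≤ n<m) | I n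
  ... | ih | false = subst₂ _≤_ (sym (+-identityʳ _)) (cong (∑ (x (suc n))) (sym (+-identityʳ k)))
        (≤-trans ih (∑-mono k (λ j _ → grow n j)))
    where k = card I n
  ... | ih | true = subst₂ _≤_ (cong (w +_) (sym (+-identityʳ (α n))))
        (sym (trans (cong (∑ (x (suc n))) (+-comm k 1)) (∑-head (x (suc n)) k)))
        (+-cancelʳ-≤ X _ _ chain)
    where
    open ≤-Reasoning
    k w X a : ℕ
    k = card I n
    w = weight I α n
    X = ∑ (x n) m
    a = x (suc n) 0
    chain : (w + α n) + X ≤ (a + ∑ (x (suc n) ∘ suc) k) + X
    chain = begin
      (w + α n) + X                            ≡⟨ +-assoc w (α n) X ⟩
      -- Adding the entry at index `m` makes the sum long enough to split off its head and still
      -- leave `m` shifted terms.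
      w + (α n + X)                            ≡⟨ cong (w +_) (sym (content-∑ n<m)) ⟩
      w + ∑ (x (suc n)) m                      ≤⟨ +-mono-≤ ih (m≤m+n _ (x (suc n) m)) ⟩
      ∑ (x n) k + ∑ (x (suc n)) (suc m)        ≡⟨ cong (∑ (x n) k +_) (∑-head (x (suc n)) m) ⟩
      ∑ (x n) k + (a + ∑ (x (suc n) ∘ suc) m)  ≡⟨ x∙yz≈y∙xz (∑ (x n) k) a _ ⟩
      a + (∑ (x n) k + ∑ (x (suc n) ∘ suc) m)  ≤⟨ +-monoʳ-≤ a (∑-segment-mono (x (suc n) ∘ suc) (x n) (interlace n)
                                                    (≤⇒≤′ (≤-trans (card≤ I n) (<⇒≤ n<m)))) ⟩
      a + (X + ∑ (x (suc n) ∘ suc) k)          ≡⟨ x∙yz≈xz∙y a X _ ⟩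
      (a + ∑ (x (suc n) ∘ suc) k) + X          ∎

  ∑-content : ∀ {n} → n ≤ m → ∑ α n ≡ ∑ (x n) m
  ∑-content {zero} _ = sym (trans (∑-cong m (λ j _ → zero-row j)) (∑-0 m))
  ∑-content {suc n} n<m = trans (cong (_+ α n) (∑-content (<⇒≤ n<m)))
    (trans (+-comm _ (α n)) (sym (content-∑ n<m)))

  weight≤shape : ∀ I → weight I α m ≤ ∑ μ (card I m)
  weight≤shape I = subst (weight I α m ≤_) (∑-cong (card I m) (λ j _ → top j)) (weight≤rows I ≤-refl)

  size-content : ∑ α m ≡ ∑ μ m
  size-content = trans (∑-content ≤-refl) (∑-cong m (λ j _ → top j))

-- Polymorphic because it serves two purposes: prescribing whether an index set contains the last
-- coordinate, and placing a new top row on a pattern.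
cut : ∀ {A : Set} → ℕ → (ℕ → A) → A → ℕ → A
cut zero f a i = a
cut (suc m) f a zero = f 0
cut (suc m) f a (suc i) = cut m (f ∘ suc) a i

cut-< : ∀ {A : Set} m (f : ℕ → A) a {i} → i < m → cut m f a i ≡ f i
cut-< (suc m) f a {zero} _ = refl
cut-< (suc m) f a {suc i} (s≤s i<m) = cut-< m (f ∘ suc) a i<m

cut-≥ : ∀ {A : Set} m (f : ℕ → A) a {i} → m ≤ i → cut m f a i ≡ a
cut-≥ zero f a _ = refl
cut-≥ (suc m) f a {suc i} (s≤s m≤i) = cut-≥ m (f ∘ suc) a m≤i

-- Rado's condition suffices: removing the last variable strips the greedy horizontal strip off μ.
kostka-positive : ∀ m {μ α} → Antitone μ → (∀ {j} → m ≤ j → μ j ≡ 0) →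
  (∀ I → weight I α m ≤ ∑ μ (card I m)) → ∑ α m ≡ ∑ μ m → GelfandTsetlin m μ α
kostka-positive zero {μ} {α} μ↓ μ-vanish dom total = record
  { x = λ _ _ → 0
  ; zero-row = λ _ → refl
  ; grow = λ _ _ → z≤n
  ; interlace = λ _ _ → z≤n
  ; top = λ j → sym (μ-vanish z≤n)
  ; content-∑ = λ () }
kostka-positive (suc m) {μ} {α} μ↓ μ-vanish dom total = record
  { x = x
  ; zero-row = P.zero-row
  ; grow = grow
  ; interlace = interlace
  ; top = λ j → cong (λ row → row j) (cut-≥ (suc m) P.x μ ≤-refl)
  ; content-∑ = strip-content }
  where
  -- Rado's condition for the set that agrees with `I` below `m` and contains the last coordinate
  -- exactly when `b` holds.
  dom-last : ∀ I b → weight I α m + 𝟙 b * α m ≤ ∑ μ (card I m + 𝟙 b)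
  dom-last I b = subst₂ (λ w k → w ≤ ∑ μ k)
    (cong₂ _+_ (∑-cong m (λ i i<m → cong (λ c → 𝟙 c * α i) (cut-< m I b i<m)))
      (cong (λ c → 𝟙 c * α m) (cut-≥ m I b ≤-refl)))
    (cong₂ _+_ (∑-cong m (λ i i<m → cong 𝟙 (cut-< m I b i<m))) (cong 𝟙 (cut-≥ m I b ≤-refl)))
    (dom (cut m I b))
  total′ : ∑ α m + α m ≡ μ 0 + ∑ (μ ∘ suc) m
  total′ = trans total (∑-head μ m)
  last≤ : α m ≤ μ 0
  last≤ = subst₂ _≤_ (cong₂ _+_ (∑-0 m) (+-identityʳ (α m))) (cong (∑ μ) (cong (_+ 1) (∑-0 m)))
    (dom-last (λ _ → false) true)
  init≤ : ∑ α m ≤ ∑ μ m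
  init≤ = subst₂ _≤_ (trans (+-identityʳ _) (∑-cong m (λ i _ → +-identityʳ (α i))))
    (cong (∑ μ) (trans (+-identityʳ _) (∑-1 m))) (dom-last (λ _ → true) false)
  -- The last variable fills at most `μ 0` cells, so the others fill at least as many as `μ` has
  -- without its first row, the smallest shape that a horizontal strip can leave.
  init≥ : ∑ (μ ∘ suc) m ≤ ∑ α m
  init≥ = +-cancelˡ-≤ (μ 0) _ _ (subst (_≤ μ 0 + ∑ α m) total′
    (subst (_≤ μ 0 + ∑ α m) (+-comm (α m) (∑ α m)) (+-monoˡ-≤ (∑ α m) last≤)))
  G : Greedy (μ ∘ suc) μ m (∑ α m)
  G = greedy m (μ↓ ∘ suc) μ↓ (λ {j} _ → μ↓ j) init≥ init≤
  module G = Greedy G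
  dom′ : ∀ I → weight I α m ≤ ∑ G.ν (card I m)
  dom′ I with G.prefix (card≤ I m)
  -- The first `k` rows lose nothing: the condition on `I` without the last coordinate is enough.
  ... | inj₁ eq = subst₂ _≤_ (+-identityʳ _) (trans (cong (∑ μ) (+-identityʳ k)) (sym eq)) (dom-last I false)
    where k = card I m
  -- From row `k` on the new shape is `μ` shifted by one row. The condition on `I` together with the
  -- last coordinate, compared with the total size, bounds the first `k` rows.
  ... | inj₂ eq = +-cancelʳ-≤ (B + α m) _ _ (begin
      w + (B + α m)            ≡⟨ x∙yz≈xz∙y w B (α m) ⟩
      (w + α m) + B            ≤⟨ +-monoˡ-≤ B dom-true ⟩
      (μ 0 + C) + B            ≡⟨ xy∙z≈xz∙y (μ 0) C B ⟩
      (μ 0 + B) + C            ≡⟨ cong (_+ C) (sym total′) ⟩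
      (n + α m) + C            ≡⟨ xy∙z≈xz∙y n (α m) C ⟩
      (n + C) + α m            ≡⟨ cong (_+ α m) (sym eq) ⟩
      (∑ G.ν k + B) + α m      ≡⟨ +-assoc _ B (α m) ⟩
      ∑ G.ν k + (B + α m)      ∎)
    where
    open ≤-Reasoning
    k w n B C : ℕ
    k = card I m
    w = weight I α m
    n = ∑ α m
    B = ∑ (μ ∘ suc) m
    C = ∑ (μ ∘ suc) k
    dom-true : w + α m ≤ μ 0 + C
    dom-true = subst₂ _≤_ (cong (w +_) (+-identityʳ (α m)))
      (trans (cong (∑ μ) (+-comm k 1)) (∑-head μ k)) (dom-last I true)
  P : GelfandTsetlin m G.ν α
  P = kostka-positive m G.antitone G.vanish dom′ (sym G.total)
  module P = GelfandTsetlin P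
  -- All rows above `m` repeat `μ`, so that growth and interlacing hold for every `k`, as the record
  -- demands.
  x : ℕ → ℕ → ℕ
  x = cut (suc m) P.x μ
  below : ∀ {k} → k ≤ m → x k ≡ P.x k
  below k≤m = cut-< (suc m) P.x μ (s≤s k≤m)
  above : ∀ {k} → m < k → x k ≡ μ
  above = cut-≥ (suc m) P.x μ
  ν≤μ : ∀ j → G.ν j ≤ μ j
  ν≤μ j with j <? m
  ... | yes j<m = G.upper j<m
  ... | no j≮m = subst (_≤ μ j) (sym (G.vanish (≮⇒≥ j≮m))) z≤n
  μ≤ν : ∀ j → μ (suc j) ≤ G.ν j
  μ≤ν j with j <? m
  ... | yes j<m = G.lower j<m
  ... | no j≮m = subst (_≤ G.ν j) (sym (μ-vanish (s≤s (≮⇒≥ j≮m)))) z≤n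
  grow : ∀ k j → x k j ≤ x (suc k) j
  grow k j with <-cmp k m
  ... | tri< k<m _ _ rewrite below (<⇒≤ k<m) | below k<m = P.grow k j
  ... | tri≈ _ refl _ rewrite below (≤-refl {m}) | above (≤-refl {suc m}) | P.top j = ν≤μ j
  ... | tri> _ _ m<k rewrite above m<k | above (m<n⇒m<1+n m<k) = ≤-refl
  interlace : ∀ k j → x (suc k) (suc j) ≤ x k j
  interlace k j with <-cmp k m
  ... | tri< k<m _ _ rewrite below (<⇒≤ k<m) | below k<m = P.interlace k j
  ... | tri≈ _ refl _ rewrite below (≤-refl {m}) | above (≤-refl {suc m}) | P.top j = μ≤ν j
  ... | tri> _ _ m<k rewrite above m<k | above (m<n⇒m<1+n m<k) = μ↓ j
  ∑-below : ∀ {k} → k ≤ m → ∑ (x k) (suc m) ≡ ∑ (P.x k) m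
  ∑-below {k} k≤m rewrite below k≤m | P.vanish k≤m = +-identityʳ _
  strip-content : ∀ {i} → i < suc m → ∑ (x (suc i)) (suc m) ≡ α i + ∑ (x i) (suc m)
  strip-content {i} i<1+m with m≤n⇒m<n∨m≡n (s≤s⁻¹ i<1+m)
  ... | inj₁ i<m rewrite ∑-below i<m | ∑-below (<⇒≤ i<m) = P.content-∑ i<m
  ... | inj₂ refl rewrite above (≤-refl {suc m}) | ∑-below (≤-refl {m}) =
        trans (sym total) (trans (+-comm _ (α m)) (cong (α m +_) (P.∑-content ≤-refl)))

-- Rounding a pattern into smaller patterns

module _ {m : ℕ} {μ α : ℕ → ℕ} (P : GelfandTsetlin m μ α) {φ : ℕ → ℕ}
         (φ-mono : ∀ {a b} → a ≤ b → φ a ≤ φ b) (φ-zero : φ 0 ≡ 0) where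
  open GelfandTsetlin P

  map-content : ℕ → ℕ
  map-content i = ∑ (φ ∘ x (suc i)) m ∸ ∑ (φ ∘ x i) m

  map-content-∑ : ∀ i → ∑ (φ ∘ x (suc i)) m ≡ map-content i + ∑ (φ ∘ x i) m
  map-content-∑ i = sym (m∸n+n≡m (∑-mono m (λ j _ → φ-mono (grow i j))))

  -- Growth and interlacing only compare entries, so a monotone map that fixes 0 preserves them. The
  -- new content is whatever the new row sums dictate.
  mapPattern : GelfandTsetlin m (φ ∘ μ) map-content
  mapPattern = record
    { x = λ k → φ ∘ x k
    ; zero-row = λ j → trans (cong φ (zero-row j)) φ-zero
    ; grow = λ k j → φ-mono (grow k j)
    ; interlace = λ k j → φ-mono (interlace k j)
    ; top = λ j → cong φ (top j)
    ; content-∑ = λ {i} _ → map-content-∑ i }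

-- Hermite's identity in its integral form.
∑-⌊/⌋ : ∀ t .{{_ : NonZero t}} n → ∑ (λ i → (n + i) / t) t ≡ n
∑-⌊/⌋ t zero = trans (∑-cong t (λ i i<t → m<n⇒m/n≡0 i<t)) (∑-0 t)
-- Passing from `n` to `n + 1` shifts the window of summands by one: `n / t` leaves and
-- `(n + t) / t`, which is larger by 1, enters.
∑-⌊/⌋ t (suc n) = +-cancelˡ-≡ ((n + 0) / t) _ _ (begin
  f 0 + ∑ (λ i → (suc n + i) / t) t  ≡⟨ cong (f 0 +_) (∑-cong t (λ i _ → cong (_/ t) (sym (+-suc n i)))) ⟩
  f 0 + ∑ (f ∘ suc) t                ≡⟨ sym (∑-head f t) ⟩
  ∑ f t + f t                        ≡⟨ cong₂ _+_ (∑-⌊/⌋ t n) step ⟩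
  n + suc (n / t)                    ≡⟨ +-suc n (n / t) ⟩
  suc (n + n / t)                    ≡⟨ cong suc (+-comm n (n / t)) ⟩
  suc (n / t + n)                    ≡⟨ sym (+-suc (n / t) n) ⟩
  n / t + suc n                      ≡⟨ cong (λ a → a / t + suc n) (sym (+-identityʳ n)) ⟩
  f 0 + suc n                        ∎)
  where
  open ≡-Reasoning
  f : ℕ → ℕ
  f i = (n + i) / t
  step : (n + t) / t ≡ suc (n / t)
  step = trans (m/n≡1+[m∸n]/n (m≤n+m t n)) (cong (λ a → suc (a / t)) (m+n∸n≡m n t))

module Split {m : ℕ} {ν p : ℕ → ℕ} (P : GelfandTsetlin m ν p) (t : ℕ) .{{_ : NonZero t}} where

  φ : ℕ → ℕ → ℕ
  φ i a = (a + i) / t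

  φ-mono : ∀ i {a b} → a ≤ b → φ i a ≤ φ i b
  φ-mono i a≤b = /-monoˡ-≤ t (+-monoˡ-≤ i a≤b)

  φ-zero : ∀ {i} → i < t → φ i 0 ≡ 0
  φ-zero = m<n⇒m/n≡0

  φ-lower : ∀ i {a c} → t * c ≤ a → c ≤ φ i a
  φ-lower i {a} {c} tc≤a = subst (_≤ φ i a) (trans (cong (_/ t) (*-comm t c)) (m*n/n≡m c t))
    (/-monoˡ-≤ t (m≤n⇒m≤n+o i tc≤a))

  -- As `i < t`, the offset cannot carry `t * c` to the next multiple of `t`.
  φ-upper : ∀ {i} → i < t → ∀ {a c} → a ≤ t * c → φ i a ≤ c
  φ-upper {i} i<t {a} {c} a≤tc = s≤s⁻¹ (m<n*o⇒m/o<n (subst (a + i <_) (trans (+-comm (t * c) t)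
    (trans (sym (*-suc t c)) (*-comm t (suc c)))) (+-mono-≤-< a≤tc i<t)))

  part : ∀ {i} → i < t → GelfandTsetlin m (φ i ∘ ν) _
  part {i} i<t = mapPattern P (φ-mono i) (φ-zero i<t)

  -- The value of `map-content` freed from the proof of `i < t`, so that it can be summed over `i`.
  part-content : ℕ → ℕ → ℕ
  part-content i k = ∑ (φ i ∘ GelfandTsetlin.x P (suc k)) m ∸ ∑ (φ i ∘ GelfandTsetlin.x P k) m

  -- A content is a difference of consecutive row sums, and Hermite's identity, applied entry by
  -- entry, restores each row sum of `P`.
  ∑-part-content : ∀ {k} → k < m → ∑ (λ i → part-content i k) t ≡ p k
  ∑-part-content {k} k<m = +-cancelʳ-≡ (∑ (x k) m) _ _ (begin
    ∑ (λ i → part-content i k) t + ∑ (x k) m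
      ≡⟨ cong (∑ (λ i → part-content i k) t +_) (sym (hermite k)) ⟩
    ∑ (λ i → part-content i k) t + ∑ (λ i → ∑ (φ i ∘ x k) m) t
      ≡⟨ sym (∑-+ _ _ t) ⟩
    ∑ (λ i → part-content i k + ∑ (φ i ∘ x k) m) t
      ≡⟨ ∑-cong t (λ i i<t → sym (map-content-∑ P (φ-mono i) (φ-zero i<t) k)) ⟩
    ∑ (λ i → ∑ (φ i ∘ x (suc k)) m) t
      ≡⟨ hermite (suc k) ⟩
    ∑ (x (suc k)) m
      ≡⟨ content-∑ k<m ⟩
    p k + ∑ (x k) m ∎)
    where
    open GelfandTsetlin P
    open ≡-Reasoning
    hermite : ∀ k → ∑ (λ i → ∑ (φ i ∘ x k) m) t ≡ ∑ (x k) m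
    hermite k = trans (∑-swap _ t m) (∑-cong m (λ j _ → ∑-⌊/⌋ t (x k j)))

-- Semistandard tableaux

𝟙-true : ∀ {b} → T b → 𝟙 b ≡ 1
𝟙-true {true} _ = refl

𝟙-false : ∀ {b} → ¬ T b → 𝟙 b ≡ 0
𝟙-false {false} _ = refl
𝟙-false {true} ¬t = contradiction tt ¬t

𝟙-mono : ∀ {a b} → (T a → T b) → 𝟙 a ≤ 𝟙 b
𝟙-mono {false} _ = z≤n
𝟙-mono {true} a⇒b = ≤-reflexive (sym (𝟙-true (a⇒b tt)))

𝟙-cong : ∀ {a b} → (T a → T b) → (T b → T a) → 𝟙 a ≡ 𝟙 b
𝟙-cong a⇒b b⇒a = ≤-antisym (𝟙-mono a⇒b) (𝟙-mono b⇒a)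

𝟙-≤-suc : ∀ a i → 𝟙 (a ≤ᵇ suc i) ≡ 𝟙 (a ≡ᵇ suc i) + 𝟙 (a ≤ᵇ i)
𝟙-≤-suc a i with <-cmp a (suc i)
... | tri< a<1+i a≢ _ = trans (𝟙-true (≤⇒≤ᵇ (<⇒≤ a<1+i)))
      (sym (cong₂ _+_ (𝟙-false (a≢ ∘ ≡ᵇ⇒≡ a (suc i))) (𝟙-true (≤⇒≤ᵇ (s≤s⁻¹ a<1+i)))))
... | tri≈ _ refl _ = trans (𝟙-true (≤⇒≤ᵇ (≤-refl {suc i})))
      (sym (cong₂ _+_ (𝟙-true (≡⇒≡ᵇ a a refl)) (𝟙-false (n≮n i ∘ ≤ᵇ⇒≤ (suc i) i))))
... | tri> _ a≢ 1+i<a = trans (𝟙-false (<⇒≱ 1+i<a ∘ ≤ᵇ⇒≤ a (suc i)))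
      (sym (cong₂ _+_ (𝟙-false (a≢ ∘ ≡ᵇ⇒≡ a (suc i))) (𝟙-false (<⇒≱ (<⇒≤ 1+i<a) ∘ ≤ᵇ⇒≤ a i))))

∑-monoʳ : ∀ f {k n} → k ≤′ n → ∑ f k ≤ ∑ f n
∑-monoʳ f ≤′-refl = ≤-refl
∑-monoʳ f (≤′-step k≤n) = ≤-trans (∑-monoʳ f k≤n) (m≤m+n _ _)

∑-truncate : ∀ f {k n} → k ≤′ n → (∀ {i} → k ≤ i → f i ≡ 0) → ∑ f n ≡ ∑ f k
∑-truncate f ≤′-refl f≡0 = refl
∑-truncate f (≤′-step k≤n) f≡0 =
  trans (cong₂ _+_ (∑-truncate f k≤n f≡0) (f≡0 (≤′⇒≤ k≤n))) (+-identityʳ _)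

∑-initial : ∀ {y n} → y ≤ n → ∑ (λ c → 𝟙 (c <ᵇ y)) n ≡ y
∑-initial {y} {n} y≤n = trans (∑-truncate _ (≤⇒≤′ y≤n) (λ {c} y≤c → 𝟙-false (≤⇒≯ y≤c ∘ <ᵇ⇒< c y)))
  (trans (∑-cong y (λ c c<y → 𝟙-true (<⇒<ᵇ c<y))) (∑-1 y))

record Tableau (m : ℕ) (μ α : ℕ → ℕ) : Set where
  field
    entry      : ℕ → ℕ → ℕ
    positive   : ∀ {j c} → c < μ j → 1 ≤ entry j c
    bounded    : ∀ {j c} → c < μ j → entry j c ≤ m
    row-weak   : ∀ {j c c′} → c < c′ → c′ < μ j → entry j c ≤ entry j c′
    col-strict : ∀ {j j′ c} → j < j′ → c < μ j → c < μ j′ → entry j c < entry j′ c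
    content-∑  : ∀ {i} → i < m → ∑ (λ j → ∑ (λ c → 𝟙 (entry j c ≡ᵇ suc i)) (μ j)) m ≡ α i

  entries≤ : ℕ → ℕ → ℕ
  entries≤ k j = ∑ (λ c → 𝟙 (entry j c ≤ᵇ k)) (μ j)

entries≤-suc : ∀ (entry : ℕ → ℕ) n i →
  ∑ (λ c → 𝟙 (entry c ≤ᵇ suc i)) n ≡ ∑ (λ c → 𝟙 (entry c ≡ᵇ suc i)) n + ∑ (λ c → 𝟙 (entry c ≤ᵇ i)) n
entries≤-suc entry n i = trans (∑-cong n (λ c _ → 𝟙-≤-suc (entry c) i)) (∑-+ _ _ n)

-- Interlacing is column strictness: if an entry of row `j + 1` is at most `k + 1`, the entry above
-- it is at most `k`.
tableau⇒pattern : ∀ {m μ α} → Antitone μ → Tableau m μ α → GelfandTsetlin m μ α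
tableau⇒pattern {m} {μ} {α} μ↓ S = record
  { x = entries≤
  ; zero-row = λ j → trans
      (∑-cong (μ j) (λ c c<μ → 𝟙-false (<⇒≱ (positive c<μ) ∘ ≤ᵇ⇒≤ (entry j c) 0))) (∑-0 (μ j))
  ; grow = λ k j → ∑-mono (μ j) (λ c _ →
      𝟙-mono (≤⇒≤ᵇ ∘ m≤n⇒m≤1+n ∘ ≤ᵇ⇒≤ (entry j c) k))
  ; interlace = λ k j → ≤-trans
      (∑-mono (μ (suc j)) (λ c c<μ → 𝟙-mono (λ t → ≤⇒≤ᵇ (s≤s⁻¹
        (<-≤-trans (col-strict ≤-refl (<-≤-trans c<μ (μ↓ j)) c<μ) (≤ᵇ⇒≤ (entry (suc j) c) (suc k) t))))))
      (∑-monoʳ (λ c → 𝟙 (entry j c ≤ᵇ k)) (≤⇒≤′ (μ↓ j)))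
  ; top = λ j → trans (∑-cong (μ j) (λ c c<μ → 𝟙-true (≤⇒≤ᵇ (bounded c<μ)))) (∑-1 (μ j))
  ; content-∑ = λ {i} i<m → trans (∑-cong m (λ j _ → entries≤-suc (entry j) (μ j) i))
      (trans (∑-+ _ _ m) (cong (_+ ∑ (entries≤ i) m) (content-∑ i<m))) }
  where open Tableau S

pattern⇒tableau : ∀ {m μ α} → Antitone μ → GelfandTsetlin m μ α → Tableau m μ α
pattern⇒tableau {m} {μ} {α} μ↓ P = record
  { entry = entry
  ; positive = positive
  ; bounded = λ {j} {c} _ → bounded j c
  ; row-weak = λ {j} {c} {c′} c<c′ _ → ∑-mono m (λ k _ →
      𝟙-mono (λ t → ≤⇒≤ᵇ (≤-trans (≤ᵇ⇒≤ (x k j) c t) (<⇒≤ c<c′))))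
  ; col-strict = λ j<j′ _ c<μ → col-strict (≤⇒≤′ j<j′) c<μ
  ; content-∑ = entry-content }
  where
  open GelfandTsetlin P
  entry : ℕ → ℕ → ℕ
  -- The rows of the pattern grow, so for a cell of the shape this counts the rows that do not yet
  -- cover it and is therefore the index of the first one that does.
  entry j c = ∑ (λ k → 𝟙 (x k j ≤ᵇ c)) m
  rows↑ : ∀ {k k′ j} → k ≤′ k′ → x k j ≤ x k′ j
  rows↑ ≤′-refl = ≤-refl
  rows↑ (≤′-step k≤k′) = ≤-trans (rows↑ k≤k′) (grow _ _)
  top< : ∀ {j c} → c < μ j → c < x m j
  top< {j} {c} = subst (c <_) (sym (top j))
  bounded : ∀ j c → entry j c ≤ m
  bounded j c = subst (entry j c ≤_) (∑-1 m) (∑-mono m (λ k _ → 𝟙≤1 (x k j ≤ᵇ c)))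
  entry≤ : ∀ {k j c} → k ≤ m → c < x k j → entry j c ≤ k
  entry≤ {k} {j} {c} k≤m c<x = subst₂ _≤_
    (sym (∑-truncate _ (≤⇒≤′ k≤m) (λ {i} k≤i → 𝟙-false
      (<⇒≱ (<-≤-trans c<x (rows↑ (≤⇒≤′ k≤i))) ∘ ≤ᵇ⇒≤ (x i j) c))))
    (∑-1 k) (∑-mono k (λ i _ → 𝟙≤1 (x i j ≤ᵇ c)))
  entry> : ∀ {k j c} → k < m → x k j ≤ c → k < entry j c
  entry> {k} {j} {c} k<m x≤c = subst (_≤ entry j c)
    (trans (∑-cong (suc k) (λ i i<1+k → 𝟙-true (≤⇒≤ᵇ (≤-trans (rows↑ (≤⇒≤′ (s≤s⁻¹ i<1+k))) x≤c)))) (∑-1 (suc k)))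
    (∑-monoʳ (λ i → 𝟙 (x i j ≤ᵇ c)) (≤⇒≤′ k<m))
  0-row : ∀ {k} j c → k ≡ 0 → x k j ≤ c
  0-row j c refl = subst (_≤ c) (sym (zero-row j)) z≤n
  positive : ∀ {j c} → c < μ j → 1 ≤ entry j c
  positive {j} {c} c<μ = entry> (n≢0⇒n>0 λ m≡0 → <⇒≱ (top< c<μ) (0-row j c m≡0)) (0-row j c refl)
  col-adjacent : ∀ {j c} → c < μ (suc j) → entry j c < entry (suc j) c
  col-adjacent {j} {c} c<μ = entry> v<m (row-v (entry j c) refl)
    where
    -- Since `c < x m (suc j)`, interlacing shows that pattern row `m - 1` already covers the cell
    -- above.
    before-top : ∀ {n} → n ≡ m → entry j c < n
    before-top {zero} 0≡m = contradiction (0-row (suc j) c (sym 0≡m)) (<⇒≱ (top< c<μ))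
    before-top {suc n} refl = s≤s (entry≤ (n≤1+n n) (<-≤-trans (top< c<μ) (interlace n j)))
    v<m : entry j c < m
    v<m = before-top refl
    -- Pattern row `v - 1` does not cover the cell `(j , c)`, so by interlacing row `v` does not
    -- cover the cell below it. The entry is generalised to `v` to allow the case split.
    row-v : ∀ v → v ≡ entry j c → x v (suc j) ≤ c
    row-v zero _ = 0-row (suc j) c refl
    row-v (suc k) eq = ≤-trans (interlace k j) (≮⇒≥ λ c<x →
      <⇒≱ (≤-reflexive eq) (entry≤ (<⇒≤ (<-trans (n<1+n k) (subst (_< m) (sym eq) v<m))) c<x))
  col-strict : ∀ {j j′ c} → suc j ≤′ j′ → c < μ j′ → entry j c < entry j′ c
  col-strict ≤′-refl c<μ = col-adjacent c<μ
  col-strict (≤′-step j<j′) c<μ = <-trans (col-strict j<j′ (<-≤-trans c<μ (μ↓ _))) (col-adjacent c<μ)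
  entries≤k : ∀ {k} j → k ≤ m → ∑ (λ c → 𝟙 (entry j c ≤ᵇ k)) (μ j) ≡ x k j
  entries≤k {k} j k≤m = trans (∑-cong (μ j) (λ c c<μ → 𝟙-cong (to c<μ) from))
    (∑-initial (subst (x k j ≤_) (top j) (rows↑ (≤⇒≤′ k≤m))))
    where
    from : ∀ {c} → T (c <ᵇ x k j) → T (entry j c ≤ᵇ k)
    from {c} t = ≤⇒≤ᵇ (entry≤ k≤m (<ᵇ⇒< c (x k j) t))
    to : ∀ {c} → c < μ j → T (entry j c ≤ᵇ k) → T (c <ᵇ x k j)
    to {c} c<μ t with m≤n⇒m<n∨m≡n k≤m
    ... | inj₂ refl = <⇒<ᵇ (top< c<μ)
    ... | inj₁ k<m = <⇒<ᵇ (≰⇒> λ x≤c → <⇒≱ (entry> k<m x≤c) (≤ᵇ⇒≤ (entry j c) k t))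
  entry-content : ∀ {i} → i < m → ∑ (λ j → ∑ (λ c → 𝟙 (entry j c ≡ᵇ suc i)) (μ j)) m ≡ α i
  entry-content {i} i<m = +-cancelʳ-≡ (∑ (x i) m) _ _ (trans (sym (∑-+ _ _ m))
    (trans (∑-cong m (λ j _ → trans
      (cong (∑ (λ c → 𝟙 (entry j c ≡ᵇ suc i)) (μ j) +_) (sym (entries≤k j (<⇒≤ i<m))))
      (trans (sym (entries≤-suc (entry j) (μ j) i)) (entries≤k j i<m))))
    (content-∑ i<m)))

-- Fillings as lists

-- Padding by zeros turns vectors into the infinite sequences on which patterns are defined.
at : ∀ {m} → Vec ℕ m → ℕ → ℕ
at [] j = 0
at (a ∷ v) zero = a
at (a ∷ v) (suc j) = at v j

at-≥ : ∀ {m} (v : Vec ℕ m) {j} → m ≤ j → at v j ≡ 0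
at-≥ [] _ = refl
at-≥ (a ∷ v) {suc j} (s≤s m≤j) = at-≥ v m≤j

at-tabulate : ∀ m (f : ℕ → ℕ) {j} → j < m → at (tabulate {n = m} (f ∘ toℕ)) j ≡ f j
at-tabulate (suc m) f {zero} _ = refl
at-tabulate (suc m) f {suc j} (s≤s j<m) = at-tabulate m (f ∘ suc) j<m

at-replicate : ∀ m j → at (replicate m 0) j ≡ 0
at-replicate zero j = refl
at-replicate (suc m) zero = refl
at-replicate (suc m) (suc j) = at-replicate m j

-- The recursions behind skewCells and candidates are local to Defs, at row 0; abstracting that 0
-- lets unification name them.
mutual
  cells : ∀ {k} → ℕ → Vec ℕ k → Vec ℕ k → List Cell
  cells = _

  skewCells≡cells : ∀ {m} (la mu : Vec ℕ m) → skewCells la mu ≡ cells 0 la mu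
  skewCells≡cells with 0
  ... | r = λ la mu → refl

mutual
  boxVectors : ∀ {k} → ℕ → ℕ → Vec ℕ k → List (Vec ℕ k)
  boxVectors = _

  candidates≡boxVectors : ∀ {m} h (la : Vec ℕ m) → candidates h la ≡ boxVectors h 0 la
  candidates≡boxVectors with 0
  ... | r = λ h la → refl

-- Boolean tests and counting

∧⁺ : ∀ {a b} → T a → T b → T (a ∧ b)
∧⁺ ta tb = Equivalence.from T-∧ (ta , tb)

∧⁻ : ∀ {a b} → T (a ∧ b) → T a × T b
∧⁻ = Equivalence.to T-∧

implies⁺ : ∀ {a b} → (T a → T b) → T (implies a b)
implies⁺ {false} _ = tt
implies⁺ {true} a⇒b = a⇒b tt

implies⁻ : ∀ {a b} → T (implies a b) → T a → T b
implies⁻ {true} t _ = t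

module _ {A : Set} where

  allᵇ⁺ : ∀ (p : A → Bool) xs → (∀ {x} → x ∈ xs → T (p x)) → T (allᵇ p xs)
  allᵇ⁺ p [] h = tt
  allᵇ⁺ p (x ∷ xs) h = ∧⁺ (h (here refl)) (allᵇ⁺ p xs (h ∘ there))

  allᵇ⁻ : ∀ (p : A → Bool) xs → T (allᵇ p xs) → ∀ {x} → x ∈ xs → T (p x)
  allᵇ⁻ p (x ∷ xs) t (here refl) = proj₁ (∧⁻ {p x} t)
  allᵇ⁻ p (x ∷ xs) t (there x∈) = allᵇ⁻ p xs (proj₂ (∧⁻ {p x} t)) x∈

  allPairs⁺ : ∀ (p : A → A → Bool) xs → (∀ {x y} → x ∈ xs → y ∈ xs → T (p x y)) → T (allPairs p xs)
  allPairs⁺ p xs h = allᵇ⁺ _ xs (λ x∈ → allᵇ⁺ _ xs (h x∈))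

  allPairs⁻ : ∀ (p : A → A → Bool) xs → T (allPairs p xs) → ∀ {x y} → x ∈ xs → y ∈ xs → T (p x y)
  allPairs⁻ p xs t x∈ = allᵇ⁻ _ xs (allᵇ⁻ _ xs t x∈)

  countᵇ≢0⁺ : ∀ (p : A → Bool) {xs x} → x ∈ xs → T (p x) → countᵇ p xs ≢ 0
  countᵇ≢0⁺ p {xs} x∈ px with filterᵇ p xs | ∈-filter⁺ (T? ∘ p) x∈ px
  ... | _ ∷ _ | _ = λ ()

  countᵇ≢0⁻ : ∀ (p : A → Bool) xs → countᵇ p xs ≢ 0 → ∃ λ x → x ∈ xs × T (p x)
  countᵇ≢0⁻ p xs ≢0 with filterᵇ p xs in eq
  ... | [] = contradiction refl ≢0
  ... | y ∷ _ = y , ∈-filter⁻ (T? ∘ p) (subst (y ∈_) (sym eq) (here refl))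

  countᵇ-++ : ∀ (p : A → Bool) xs ys → countᵇ p (xs ++ ys) ≡ countᵇ p xs + countᵇ p ys
  countᵇ-++ p xs ys = trans (cong length (filter-++ (T? ∘ p) xs ys)) (length-++ (filterᵇ p xs))

  countᵇ-∷ : ∀ (p : A → Bool) x xs → countᵇ p (x ∷ xs) ≡ 𝟙 (p x) + countᵇ p xs
  countᵇ-∷ p x xs with p x
  ... | false = refl
  ... | true = refl

  countᵇ-applyUpTo : ∀ (p : A → Bool) (f : ℕ → A) n → countᵇ p (applyUpTo f n) ≡ ∑ (𝟙 ∘ p ∘ f) n
  countᵇ-applyUpTo p f zero = refl
  countᵇ-applyUpTo p f (suc n) = trans (countᵇ-∷ p (f 0) _)
    (trans (cong (𝟙 (p (f 0)) +_) (countᵇ-applyUpTo p (f ∘ suc) n)) (sym (∑-head (𝟙 ∘ p ∘ f) n)))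

countᵇ-map : ∀ {A B : Set} (p : A → Bool) (f : B → A) xs → countᵇ p (map f xs) ≡ countᵇ (p ∘ f) xs
countᵇ-map p f [] = refl
countᵇ-map p f (x ∷ xs) = trans (countᵇ-∷ p (f x) (map f xs))
  (trans (cong (𝟙 (p (f x)) +_) (countᵇ-map p f xs)) (sym (countᵇ-∷ (p ∘ f) x xs)))

m+n<o⇒n<o∸m : ∀ m {n o} → m + n < o → n < o ∸ m
m+n<o⇒n<o∸m zero n<o = n<o
m+n<o⇒n<o∸m (suc m) {o = suc o} m+n<o = m+n<o⇒n<o∸m m (s≤s⁻¹ m+n<o)

n<o∸m⇒m+n<o : ∀ m {n o} → n < o ∸ m → m + n < o
n<o∸m⇒m+n<o zero n<o = n<o
n<o∸m⇒m+n<o (suc m) {o = suc o} n<o = s≤s (n<o∸m⇒m+n<o m n<o)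

cells⁺ : ∀ {k} r (la mu : Vec ℕ k) {j c} → at la j ≤ c → c < at mu j → (r + j , c) ∈ cells r la mu
cells⁺ r [] [] _ ()
cells⁺ r (l ∷ la) (u ∷ mu) {zero} {c} l≤c c<u
  rewrite +-identityʳ r | sym (m+[n∸m]≡n l≤c) =
  ∈-++⁺ˡ (∈-map⁺ (λ c → (r , l + c)) (∈-upTo⁺ (m+n<o⇒n<o∸m l c<u)))
cells⁺ r (l ∷ la) (u ∷ mu) {suc j} la≤c c<mu rewrite +-suc r j =
  ∈-++⁺ʳ (map (λ c → (r , l + c)) (upTo (u ∸ l))) (cells⁺ (suc r) la mu la≤c c<mu)

record InShape {k} (r : ℕ) (la mu : Vec ℕ k) (cell : Cell) : Set where
  constructor inShape
  field
    row   : ℕ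
    row<  : row < k
    row≡  : proj₁ cell ≡ r + row
    left  : at la row ≤ proj₂ cell
    right : proj₂ cell < at mu row

cells⁻ : ∀ {k} r (la mu : Vec ℕ k) {cell} → cell ∈ cells r la mu → InShape r la mu cell
cells⁻ r [] [] ()
cells⁻ r (l ∷ la) (u ∷ mu) cell∈ with ∈-++⁻ (map (λ c → (r , l + c)) (upTo (u ∸ l))) cell∈
... | inj₁ first with ∈-map⁻ (λ c → (r , l + c)) first
...   | d , d∈ , refl = inShape 0 z<s (sym (+-identityʳ r)) (m≤m+n l d) (n<o∸m⇒m+n<o l (∈-upTo⁻ d∈))
cells⁻ r (l ∷ la) (u ∷ mu) cell∈ | inj₂ rest with cells⁻ (suc r) la mu rest
... | inShape j j<k eq la≤ <mu = inShape (suc j) (s≤s j<k) (trans eq (sym (+-suc r j))) la≤ <mu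

-- Without repetitions, a list of values along the cells is a function of the cell; `zip-graph`
-- relies on this.
cells-unique : ∀ {k} r (la mu : Vec ℕ k) → Unique (cells r la mu)
cells-unique r [] [] = []
cells-unique r (l ∷ la) (u ∷ mu) = Unique.++⁺
  (Unique.map⁺ (λ {x} {y} eq → +-cancelˡ-≡ l x y (cong proj₂ eq)) (Unique.upTo⁺ (u ∸ l)))
  (cells-unique (suc r) la mu)
  λ { (first , rest) → disjoint first rest }
  where
  disjoint : ∀ {cell} → cell ∈ map (λ c → (r , l + c)) (upTo (u ∸ l)) → ¬ cell ∈ cells (suc r) la mu
  disjoint first rest with ∈-map⁻ (λ c → (r , l + c)) first | cells⁻ (suc r) la mu rest
  ... | _ , _ , refl | inShape j _ eq _ _ = m≢1+m+n r eq

countᵇ-cells : ∀ {k} (P : ℕ → ℕ → Bool) r (mu : Vec ℕ k) →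
  countᵇ (uncurry P) (cells r (replicate k 0) mu) ≡ ∑ (λ j → ∑ (λ c → 𝟙 (P (r + j) c)) (at mu j)) k
countᵇ-cells P r [] = refl
countᵇ-cells {suc k} P r (u ∷ mu) = begin
  countᵇ (uncurry P) (map (r ,_) (upTo u) ++ cells (suc r) (replicate k 0) mu)
    ≡⟨ countᵇ-++ (uncurry P) (map (r ,_) (upTo u)) _ ⟩
  countᵇ (uncurry P) (map (r ,_) (upTo u)) + countᵇ (uncurry P) (cells (suc r) (replicate k 0) mu)
    ≡⟨ cong₂ _+_
         (trans (countᵇ-map (uncurry P) (r ,_) (upTo u)) (trans (countᵇ-applyUpTo (P r) id u)
           (∑-cong u (λ c _ → cong (λ i → 𝟙 (P i c)) (sym (+-identityʳ r))))))
         (trans (countᵇ-cells P (suc r) mu) (∑-cong k (λ j _ → ∑-cong (at mu j) (λ c _ →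
           cong (λ i → 𝟙 (P i c)) (sym (+-suc r j)))))) ⟩
  F 0 + ∑ (F ∘ suc) k
    ≡⟨ sym (∑-head F k) ⟩
  ∑ F (suc k) ∎
  where
  open ≡-Reasoning
  F : ℕ → ℕ
  F j = ∑ (λ c → 𝟙 (P (r + j) c)) (at (u ∷ mu) j)

graph : {A : Set} → (A → ℕ) → List A → List (A × ℕ)
graph f = map (λ c → c , f c)

graph⁻ : ∀ {A : Set} {f : A → ℕ} {cs e} → e ∈ graph f cs → ∃ λ c → c ∈ cs × e ≡ (c , f c)
graph⁻ = ∈-map⁻ _

listsBelow⁺ : ∀ {A : Set} (f : A → ℕ) cs {B} → (∀ {c} → c ∈ cs → f c < B) →
  map f cs ∈ listsBelow (length cs) B
listsBelow⁺ f [] h = here refl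
listsBelow⁺ f (c ∷ cs) h = ∈-concatMap⁺ _
  (lose (∈-upTo⁺ (h (here refl))) (∈-map⁺ (f c ∷_) (listsBelow⁺ f cs (h ∘ there))))

listsBelow⁻ : ∀ n {B xs} → xs ∈ listsBelow n B → length xs ≡ n
listsBelow⁻ zero (here refl) = refl
listsBelow⁻ (suc n) {B} xs∈ with find (∈-concatMap⁻ (λ x → map (x ∷_) (listsBelow n B)) {xs = upTo B} xs∈)
... | x , _ , xs∈′ with ∈-map⁻ (x ∷_) xs∈′
...   | ys , ys∈ , refl = cong suc (listsBelow⁻ n ys∈)

zip-map : ∀ {A : Set} (f : A → ℕ) cs → zip cs (map f cs) ≡ graph f cs
zip-map f [] = refl
zip-map f (c ∷ cs) = cong (_ ∷_) (zip-map f cs)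

fillings⁺ : ∀ (f : Cell → ℕ) cs {B} → (∀ {c} → c ∈ cs → f c ≤ B) → graph f cs ∈ fillings cs B
fillings⁺ f cs f≤B = subst (_∈ _) (zip-map f cs) (∈-map⁺ (zip cs) (listsBelow⁺ f cs (s≤s ∘ f≤B)))

-- The function for the tail is overridden at the head cell; as this cell does not recur, the graph
-- over the tail stays the same.
zip-graph : ∀ {cs : List Cell} → Unique cs → ∀ xs → length xs ≡ length cs → ∃ λ f → zip cs xs ≡ graph f cs
zip-graph [] [] _ = (λ _ → 0) , refl
zip-graph {c₀ ∷ cs} (c₀∉ ∷ unique) (x ∷ xs) eq with zip-graph unique xs (suc-injective eq)
... | f , zip≡ = g , cong₂ _∷_ (cong (c₀ ,_) (sym g-new)) (trans zip≡ (graph-cong cs c₀∉))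
  where
  g : Cell → ℕ
  g c with ≡-dec _≟_ _≟_ c c₀
  ... | yes _ = x
  ... | no _ = f c
  g-new : g c₀ ≡ x
  g-new with ≡-dec _≟_ _≟_ c₀ c₀
  ... | yes _ = refl
  ... | no c≢c = contradiction refl c≢c
  g-old : ∀ {c} → c₀ ≢ c → f c ≡ g c
  g-old {c} c₀≢c with ≡-dec _≟_ _≟_ c c₀
  ... | yes c≡c₀ = contradiction (sym c≡c₀) c₀≢c
  ... | no _ = refl
  graph-cong : ∀ ds → All (c₀ ≢_) ds → graph f ds ≡ graph g ds
  graph-cong [] [] = refl
  graph-cong (d ∷ ds) (≢d ∷ ≢ds) = cong₂ _∷_ (cong (d ,_) (g-old ≢d)) (graph-cong ds ≢ds)

fillings⁻ : ∀ {cs B F} → Unique cs → F ∈ fillings cs B → ∃ λ f → F ≡ graph f cs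
fillings⁻ {cs} unique F∈ with ∈-map⁻ (zip cs) F∈
... | xs , xs∈ , refl = zip-graph unique xs (listsBelow⁻ _ xs∈)

cells₀⁻ : ∀ {k} (la mu : Vec ℕ k) {r c} → (r , c) ∈ cells 0 la mu → r < k × at la r ≤ c × c < at mu r
cells₀⁻ la mu rc∈ with cells⁻ 0 la mu rc∈
... | inShape _ j<k refl la≤ <mu = j<k , la≤ , <mu

eqVecᵇ⁺ : ∀ {k} (g : ℕ → ℕ) (α : Vec ℕ k) → (∀ {i} → i < k → g i ≡ at α i) → T (eqVecᵇ (tabulate (g ∘ toℕ)) α)
eqVecᵇ⁺ g [] _ = tt
eqVecᵇ⁺ g (a ∷ α) eq = ∧⁺ (≡⇒≡ᵇ (g 0) a (eq z<s)) (eqVecᵇ⁺ (g ∘ suc) α (eq ∘ s<s))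

eqVecᵇ⁻ : ∀ {k} (g : ℕ → ℕ) (α : Vec ℕ k) → T (eqVecᵇ (tabulate (g ∘ toℕ)) α) → ∀ {i} → i < k → g i ≡ at α i
eqVecᵇ⁻ g (a ∷ α) t {zero} _ = ≡ᵇ⇒≡ (g 0) a (proj₁ (∧⁻ t))
eqVecᵇ⁻ g (a ∷ α) t {suc i} (s≤s i<k) = eqVecᵇ⁻ (g ∘ suc) α (proj₂ (∧⁻ {g 0 ≡ᵇ a} t)) i<k

countᵇ-graph : ∀ {m} (f : Cell → ℕ) (mu : Vec ℕ m) i →
  countᵇ (λ e → proj₂ e ≡ᵇ suc i) (graph f (cells 0 (replicate m 0) mu)) ≡
  ∑ (λ j → ∑ (λ c → 𝟙 (f (j , c) ≡ᵇ suc i)) (at mu j)) m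
countᵇ-graph f mu i = trans (countᵇ-map _ _ (cells 0 (replicate _ 0) mu))
  (countᵇ-cells (λ r c → f (r , c) ≡ᵇ suc i) 0 mu)

schurCoeff≢0⁺ : ∀ {m} (mu α : Vec ℕ m) → Tableau m (at mu) (at α) → schurCoeff mu α ≢ 0
schurCoeff≢0⁺ {m} mu α S = countᵇ≢0⁺ _ (fillings⁺ f cs λ c∈ → bounded (right c∈))
  (∧⁺ (∧⁺ (allᵇ⁺ _ F entries) (∧⁺ (allPairs⁺ rowWeakᵇ F rows) (allPairs⁺ colStrictᵇ F cols)))
    (eqVecᵇ⁺ (λ i → countᵇ (λ e → proj₂ e ≡ᵇ suc i) F) α
      (λ {i} i<m → trans (countᵇ-graph f mu i) (content-∑ i<m))))
  where
  open Tableau S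
  f : Cell → ℕ
  f = uncurry entry
  cs = cells 0 (replicate m 0) mu
  F = graph f cs
  right : ∀ {cell} → cell ∈ cs → proj₂ cell < at mu (proj₁ cell)
  right c∈ = proj₂ (proj₂ (cells₀⁻ (replicate m 0) mu c∈))
  entries : ∀ {e} → e ∈ F → T ((1 ≤ᵇ proj₂ e) ∧ (proj₂ e ≤ᵇ m))
  entries e∈ with graph⁻ {f = f} {cs} e∈
  ... | c , c∈ , refl = ∧⁺ (≤⇒≤ᵇ (positive (right c∈))) (≤⇒≤ᵇ (bounded (right c∈)))
  rows : ∀ {e e′} → e ∈ F → e′ ∈ F → T (rowWeakᵇ e e′)
  rows e∈ e′∈ with graph⁻ {f = f} {cs} e∈ | graph⁻ {f = f} {cs} e′∈
  ... | (r , c) , _ , refl | (r′ , c′) , c′∈ , refl = implies⁺ λ t →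
        same (≡ᵇ⇒≡ r r′ (proj₁ (∧⁻ t))) (<ᵇ⇒< c c′ (proj₂ (∧⁻ {r ≡ᵇ r′} t)))
    where
    same : r ≡ r′ → c < c′ → T (entry r c ≤ᵇ entry r′ c′)
    same refl c<c′ = ≤⇒≤ᵇ (row-weak c<c′ (right c′∈))
  cols : ∀ {e e′} → e ∈ F → e′ ∈ F → T (colStrictᵇ e e′)
  cols e∈ e′∈ with graph⁻ {f = f} {cs} e∈ | graph⁻ {f = f} {cs} e′∈
  ... | (r , c) , c∈ , refl | (r′ , c′) , c′∈ , refl = implies⁺ λ t →
        same (≡ᵇ⇒≡ c c′ (proj₁ (∧⁻ t))) (<ᵇ⇒< r r′ (proj₂ (∧⁻ {c ≡ᵇ c′} t)))
    where
    same : c ≡ c′ → r < r′ → T (entry r c <ᵇ entry r′ c′)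
    same refl r<r′ = <⇒<ᵇ (col-strict r<r′ (right c∈) (right c′∈))

schurCoeff≢0⁻ : ∀ {m} (mu α : Vec ℕ m) → schurCoeff mu α ≢ 0 → Tableau m (at mu) (at α)
schurCoeff≢0⁻ {m} mu α K≢0 with countᵇ≢0⁻ _ (fillings (cells 0 (replicate m 0) mu) m) K≢0
... | F , F∈ , valid with fillings⁻ {cells 0 (replicate m 0) mu} {m} (cells-unique 0 (replicate m 0) mu) F∈
...   | f , refl = record
  { entry = λ r c → f (r , c)
  ; positive = λ c< → ≤ᵇ⇒≤ 1 _ (proj₁ (∧⁻ (entries c<)))
  ; bounded = λ {j} {c} c< → ≤ᵇ⇒≤ (f (j , c)) m (proj₂ (∧⁻ {1 ≤ᵇ f (j , c)} (entries c<)))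
  ; row-weak = λ {j} {c} {c′} c<c′ c′< → ≤ᵇ⇒≤ (f (j , c)) _ (implies⁻
      (allPairs⁻ rowWeakᵇ (graph f cs) (proj₁ (∧⁻ (proj₂ ssyt))) (e∈ (<-trans c<c′ c′<)) (e∈ c′<))
      (∧⁺ (≡⇒≡ᵇ j j refl) (<⇒<ᵇ c<c′)))
  ; col-strict = λ {j} {j′} {c} j<j′ c< c<′ → <ᵇ⇒< (f (j , c)) _ (implies⁻
      (allPairs⁻ colStrictᵇ (graph f cs) (proj₂ (∧⁻ {allPairs rowWeakᵇ (graph f cs)} (proj₂ ssyt))) (e∈ c<) (e∈ c<′))
      (∧⁺ (≡⇒≡ᵇ c c refl) (<⇒<ᵇ j<j′)))
  ; content-∑ = λ {i} i<m → trans (sym (countᵇ-graph f mu i))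
      (eqVecᵇ⁻ (λ i → countᵇ (λ e → proj₂ e ≡ᵇ suc i) (graph f cs)) α
      (proj₂ (∧⁻ {ssytValidᵇ m (graph f cs)} valid)) i<m) }
  where
  cs = cells 0 (replicate m 0) mu
  e∈ : ∀ {j c} → c < at mu j → ((j , c) , f (j , c)) ∈ graph f cs
  e∈ {j} c< = ∈-map⁺ (λ c → c , f c) (cells⁺ 0 (replicate m 0) mu (subst (_≤ _) (sym (at-replicate m j)) z≤n) c<)
  inRange : Cell × ℕ → Bool
  inRange e = (1 ≤ᵇ proj₂ e) ∧ (proj₂ e ≤ᵇ m)
  ssyt : T (allᵇ inRange (graph f cs)) × T (allPairs rowWeakᵇ (graph f cs) ∧ allPairs colStrictᵇ (graph f cs))
  ssyt = ∧⁻ {allᵇ inRange (graph f cs)} (proj₁ (∧⁻ {ssytValidᵇ m (graph f cs)} valid))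
  entries : ∀ {j c} → c < at mu j → T (inRange ((j , c) , f (j , c)))
  entries c< = allᵇ⁻ inRange (graph f cs) (proj₁ ssyt) (e∈ c<)

-- Existence of fillings and the box of shapes

minUpTo : (ℕ → ℕ) → ℕ → ℕ
minUpTo g zero = g 0
minUpTo g (suc r) = minUpTo g r ⊓ g (suc r)

minUpTo≤ : ∀ g r → minUpTo g r ≤ g r
minUpTo≤ g zero = ≤-refl
minUpTo≤ g (suc r) = m⊓n≤n _ _

minUpTo-antitone : ∀ g → Antitone (minUpTo g)
minUpTo-antitone g r = m⊓n≤m _ _

-- The universal property of the running minimum, by which `minUpTo g` is the largest antitone
-- sequence below `g`. It serves both for the entries of the explicit filling and for the largest
-- partition in the box.
≤+minUpTo : ∀ {g X} Y r → (∀ {i} → i ≤ r → X ≤ Y + g i) → X ≤ Y + minUpTo g r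
≤+minUpTo Y zero h = h z≤n
≤+minUpTo {g} {X} Y (suc r) h = subst (X ≤_) (sym (+-distribˡ-⊓ Y (minUpTo g r) _))
  (⊓-glb (≤+minUpTo Y r (h ∘ m≤n⇒m≤1+n)) (h ≤-refl))

Boxed : ℕ → (ℕ → ℕ) → (ℕ → ℕ) → ℕ → Set
Boxed h la mu m = ∀ {j} → j < m → la j ≤ mu j × mu j ≤ la j + h * j

-- One explicit filling suffices: `c + r + 1` lowered by the minimum of `la i + i` over `i ≤ r`. It
-- is positive because `la r ≤ c` in row `r`, and the bound `h * r` is checked against each term of
-- the minimum.
bCoeff≢0 : ∀ {m} h → 1 ≤ h → (la mu : Vec ℕ m) → Antitone (at mu) → Boxed h (at la) (at mu) m → bCoeff h la mu ≢ 0
bCoeff≢0 {m} h 1≤h la mu mu↓ box = countᵇ≢0⁺ _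
  (fillings⁺ f cs (λ c∈ → ≤-trans (upper c∈) (*-monoʳ-≤ h (<⇒≤ (proj₁ (cells₀⁻ la mu c∈))))))
  (∧⁺ (allᵇ⁺ _ F entries) (∧⁺ (allPairs⁺ rowStrictᵇ F rows) (allPairs⁺ colStrictᵇ F cols)))
  where
  M : ℕ → ℕ
  M = minUpTo (λ i → at la i + i)
  -- Strict in both directions: a step right or down raises c + r by one and never raises M.
  f : Cell → ℕ
  f (r , c) = suc (c + r) ∸ M r
  cs = cells 0 la mu
  F = graph f cs
  M≤ : ∀ {r c} → (r , c) ∈ cs → M r ≤ c + r
  M≤ {r} {c} c∈ = ≤-trans (minUpTo≤ _ r) (+-monoˡ-≤ r (proj₁ (proj₂ (cells₀⁻ la mu c∈))))
  upper : ∀ {r c} → (r , c) ∈ cs → f (r , c) ≤ h * r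
  upper {r} {c} c∈ = m≤n+o⇒m∸n≤o (suc (c + r)) (M r) (subst (suc (c + r) ≤_) (+-comm (h * r) (M r)) (≤+minUpTo (h * r) r bound))
    where
    open ≤-Reasoning
    r<m : r < m
    r<m = proj₁ (cells₀⁻ la mu c∈)
    -- For `r = i + d` one has `c < mu r ≤ mu i ≤ la i + h * i`, and `d ≤ h * d` accounts for the
    -- remaining `d` rows.
    bound : ∀ {i} → i ≤ r → suc (c + r) ≤ h * r + (at la i + i)
    bound {i} i≤r with m≤n⇒∃[o]m+o≡n i≤r
    ... | d , refl = begin
      suc c + (i + d)                      ≤⟨ +-monoˡ-≤ (i + d) (proj₂ (proj₂ (cells₀⁻ la mu c∈))) ⟩
      at mu (i + d) + (i + d)              ≤⟨ +-monoˡ-≤ (i + d) (antitone-≤ mu↓ (≤⇒≤′ i≤r)) ⟩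
      at mu i + (i + d)                    ≤⟨ +-monoˡ-≤ (i + d) (proj₂ (box (≤-<-trans i≤r r<m))) ⟩
      (at la i + h * i) + (i + d)          ≡⟨ trans (interchange (at la i) (h * i) i d) (+-comm (at la i + i) (h * i + d)) ⟩
      (h * i + d) + (at la i + i)          ≤⟨ +-monoˡ-≤ _ (+-monoʳ-≤ (h * i) (subst (_≤ h * d) (*-identityˡ d) (*-monoˡ-≤ d 1≤h))) ⟩
      (h * i + h * d) + (at la i + i)      ≡⟨ cong (_+ (at la i + i)) (sym (*-distribˡ-+ h i d)) ⟩
      h * (i + d) + (at la i + i)          ∎
  entries : ∀ {e} → e ∈ F → T (bEntryOkᵇ h e)
  entries e∈ with graph⁻ {f = f} {cs} e∈
  ... | (r , c) , c∈ , refl = ∧⁺ (≤⇒≤ᵇ (m<n⇒0<n∸m (s≤s (M≤ c∈)))) (≤⇒≤ᵇ (upper c∈))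
  rows : ∀ {e e′} → e ∈ F → e′ ∈ F → T (rowStrictᵇ e e′)
  rows e∈ e′∈ with graph⁻ {f = f} {cs} e∈ | graph⁻ {f = f} {cs} e′∈
  ... | (r , c) , c∈ , refl | (r′ , c′) , c′∈ , refl = implies⁺ λ t →
        same (≡ᵇ⇒≡ r r′ (proj₁ (∧⁻ t))) (<ᵇ⇒< c c′ (proj₂ (∧⁻ {r ≡ᵇ r′} t)))
    where
    same : r ≡ r′ → c < c′ → T (f (r , c) <ᵇ f (r′ , c′))
    same refl c<c′ = <⇒<ᵇ (∸-monoˡ-< (s≤s (+-monoˡ-< r c<c′)) (m≤n⇒m≤1+n (M≤ c∈)))
  cols : ∀ {e e′} → e ∈ F → e′ ∈ F → T (colStrictᵇ e e′)
  cols e∈ e′∈ with graph⁻ {f = f} {cs} e∈ | graph⁻ {f = f} {cs} e′∈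
  ... | (r , c) , c∈ , refl | (r′ , c′) , c′∈ , refl = implies⁺ λ t →
        same (≡ᵇ⇒≡ c c′ (proj₁ (∧⁻ t))) (<ᵇ⇒< r r′ (proj₂ (∧⁻ {c ≡ᵇ c′} t)))
    where
    same : c ≡ c′ → r < r′ → T (f (r , c) <ᵇ f (r′ , c′))
    same refl r<r′ = <⇒<ᵇ (<-≤-trans (∸-monoˡ-< (s≤s (+-monoʳ-< c r<r′)) (m≤n⇒m≤1+n (M≤ c∈)))
      (∸-monoʳ-≤ (suc (c + r′)) (antitone-≤ (minUpTo-antitone _) (≤⇒≤′ (<⇒≤ r<r′)))))

boxVectors⁺ : ∀ {k} h r (la mu : Vec ℕ k) → (∀ {j} → j < k → at la j ≤ at mu j × at mu j ≤ at la j + h * (r + j)) →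
  mu ∈ boxVectors h r la
boxVectors⁺ h r [] [] _ = here refl
boxVectors⁺ h r (l ∷ la) (u ∷ mu) box with m≤n⇒∃[o]m+o≡n (proj₁ (box z<s))
... | d , refl = ∈-concatMap⁺ _ (lose (∈-upTo⁺ (s≤s d≤)) (∈-map⁺ _ (boxVectors⁺ h (suc r) la mu
        (λ {j} j<k → proj₁ (box (s<s j<k)) ,
           subst (λ i → at mu j ≤ at la j + h * i) (+-suc r j) (proj₂ (box (s<s j<k)))))))
  where
  d≤ : d ≤ h * r
  d≤ = subst (λ i → d ≤ h * i) (+-identityʳ r) (+-cancelˡ-≤ l d _ (proj₂ (box z<s)))

boxVectors⁻ : ∀ {k} h r (la mu : Vec ℕ k) → mu ∈ boxVectors h r la → ∀ {j} → j < k → at la j ≤ at mu j × at mu j ≤ at la j + h * (r + j)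
boxVectors⁻ h r (l ∷ la) mu mu∈ {j} j<k
  with find (∈-concatMap⁻ (λ d → map ((l + d) ∷_) (boxVectors h (suc r) la)) {xs = upTo (suc (h * r))} mu∈)
... | d , d∈ , mu∈′ with ∈-map⁻ ((l + d) ∷_) mu∈′
...   | mu′ , mu′∈ , refl = bounds j j<k
  where
  bounds : ∀ j → j < suc _ → at (l ∷ la) j ≤ at ((l + d) ∷ mu′) j × at ((l + d) ∷ mu′) j ≤ at (l ∷ la) j + h * (r + j)
  bounds zero _ = m≤m+n l d ,
    +-monoʳ-≤ l (subst (λ i → d ≤ h * i) (sym (+-identityʳ r)) (s≤s⁻¹ (∈-upTo⁻ d∈)))
  bounds (suc j) (s≤s j<k) with boxVectors⁻ h (suc r) la mu′ mu′∈ j<k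
  ... | lower , upper = lower , subst (λ i → at mu′ j ≤ at la j + h * i) (sym (+-suc r j)) upper

isPartitionᵇ⁺ : ∀ {m} (mu : Vec ℕ m) → Antitone (at mu) → T (isPartitionᵇ mu)
isPartitionᵇ⁺ [] _ = tt
isPartitionᵇ⁺ (a ∷ []) _ = tt
isPartitionᵇ⁺ (a ∷ b ∷ mu) mu↓ = ∧⁺ (≤⇒≤ᵇ (mu↓ 0)) (isPartitionᵇ⁺ (b ∷ mu) (mu↓ ∘ suc))

isPartitionᵇ⁻ : ∀ {m} (mu : Vec ℕ m) → T (isPartitionᵇ mu) → Antitone (at mu)
isPartitionᵇ⁻ [] _ _ = z≤n
isPartitionᵇ⁻ (a ∷ []) _ _ = z≤n
isPartitionᵇ⁻ (a ∷ b ∷ mu) t zero = ≤ᵇ⇒≤ b a (proj₁ (∧⁻ t))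
isPartitionᵇ⁻ (a ∷ b ∷ mu) t (suc j) = isPartitionᵇ⁻ (b ∷ mu) (proj₂ (∧⁻ {b ≤ᵇ a} t)) j

containsᵇ⁺ : ∀ {m} (la mu : Vec ℕ m) → (∀ {j} → j < m → at la j ≤ at mu j) → T (containsᵇ la mu)
containsᵇ⁺ [] [] _ = tt
containsᵇ⁺ (l ∷ la) (u ∷ mu) la≤mu = ∧⁺ (≤⇒≤ᵇ (la≤mu z<s)) (containsᵇ⁺ la mu (la≤mu ∘ s<s))

T-not-≡ᵇ0 : ∀ {b} → b ≢ 0 → T (not (b ≡ᵇ 0))
T-not-≡ᵇ0 {zero} b≢0 = contradiction refl b≢0
T-not-≡ᵇ0 {suc b} _ = tt

module _ {m : ℕ} (h : ℕ) (la : Vec ℕ m) where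

  Aset⁺ : 1 ≤ h → ∀ mu → Antitone (at mu) → Boxed h (at la) (at mu) m → mu ∈ Aset h la
  Aset⁺ 1≤h mu mu↓ box = ∈-filter⁺ (T? ∘ _) (boxVectors⁺ h 0 la mu box)
    (∧⁺ (isPartitionᵇ⁺ mu mu↓) (∧⁺ (containsᵇ⁺ la mu (proj₁ ∘ box)) (T-not-≡ᵇ0 (bCoeff≢0 h 1≤h la mu mu↓ box))))

  -- The box is read off from the range over which `candidates` enumerates.
  Aset⁻ : ∀ {mu} → mu ∈ Aset h la → Antitone (at mu) × Boxed h (at la) (at mu) m
  Aset⁻ {mu} mu∈ with ∈-filter⁻ (T? ∘ _) {xs = candidates h la} mu∈
  ... | mu∈′ , valid = isPartitionᵇ⁻ mu (proj₁ (∧⁻ valid)) , boxVectors⁻ h 0 la mu mu∈′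

size≡∑ : ∀ {m} (v : Vec ℕ m) → size v ≡ ∑ (at v) m
size≡∑ [] = refl
size≡∑ {suc m} (a ∷ v) = trans (cong₂ _+_ {a} refl (size≡∑ v)) (sym (∑-head (at (a ∷ v)) m))

-- Support of G

open import Data.Integer using (+_)

sumℤ≢0⁻ : ∀ {A : Set} (g : A → ℤ) xs → sumℤ (map g xs) ≢ + 0 → ∃ λ x → x ∈ xs × g x ≢ + 0
sumℤ≢0⁻ g [] ≢0 = contradiction refl ≢0
sumℤ≢0⁻ g (x ∷ xs) ≢0 with g x ℤ.≟ + 0
... | no gx≢0 = x , here refl , gx≢0
... | yes gx≡0 with sumℤ≢0⁻ g xs (λ eq → ≢0 (cong₂ ℤ._+_ gx≡0 eq))
...   | y , y∈ , gy≢0 = y , there y∈ , gy≢0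

sumℤ-sameSign : ∀ {A : Set} (g : A → ℤ) (n : A → ℕ) s xs → (∀ {x} → x ∈ xs → g x ≡ s ℤ.* + n x) →
  sumℤ (map g xs) ≡ s ℤ.* + sum (map n xs)
sumℤ-sameSign g n s [] _ = sym (ℤ.*-zeroʳ s)
sumℤ-sameSign g n s (x ∷ xs) eq = trans (cong₂ ℤ._+_ (eq (here refl)) (sumℤ-sameSign g n s xs (eq ∘ there)))
  (sym (ℤ.*-distribˡ-+ s (+ n x) (+ sum (map n xs))))

∈⇒≤sum : ∀ {A : Set} (n : A → ℕ) {xs x} → x ∈ xs → n x ≤ sum (map n xs)
∈⇒≤sum n {x ∷ xs} (here refl) = m≤m+n (n x) _
∈⇒≤sum n {y ∷ xs} (there x∈) = ≤-trans (∈⇒≤sum n x∈) (m≤n+m _ (n y))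

module Support {m : ℕ} (h : ℕ) (1≤h : 1 ≤ h) (la : Vec ℕ m) where

  bCoeff′ : Vec ℕ m → ℕ
  bCoeff′ = bCoeff h la

  sign : ℕ → ℤ
  sign d = -1ℤ ℤ.^ (d ∸ size la)

  schurCoeff⇒pattern : ∀ {mu} α → mu ∈ Aset h la → schurCoeff mu α ≢ 0 → GelfandTsetlin m (at mu) (at α)
  schurCoeff⇒pattern {mu} α mu∈ K≢0 = tableau⇒pattern (proj₁ (Aset⁻ h la mu∈)) (schurCoeff≢0⁻ mu α K≢0)

  Gcoeff≢0⁻ : ∀ α → Gcoeff h la α ≢ + 0 →
    ∃ λ mu → Antitone (at mu) × Boxed h (at la) (at mu) m × GelfandTsetlin m (at mu) (at α)
  Gcoeff≢0⁻ α G≢0 with sumℤ≢0⁻ _ (Aset h la) G≢0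
  ... | mu , mu∈ , term≢0 = mu , proj₁ (Aset⁻ h la mu∈) , proj₂ (Aset⁻ h la mu∈) ,
    schurCoeff⇒pattern α mu∈ (λ K≡0 → term≢0
      (trans (cong (λ K → sign (size mu) ℤ.* (+ bCoeff′ mu) ℤ.* (+ K)) K≡0) (ℤ.*-zeroʳ (sign (size mu) ℤ.* (+ bCoeff′ mu)))))

  -- All monomials of a given degree occur with the same sign, so nothing cancels.
  Gcoeff≢0⁺ : ∀ mu α → Antitone (at mu) → Boxed h (at la) (at mu) m → GelfandTsetlin m (at mu) (at α) →
    Gcoeff h la α ≢ + 0
  Gcoeff≢0⁺ mu α mu↓ box P G≡0 with ℤ.i*j≡0⇒i≡0∨j≡0 (sign (size α)) (trans (sym (sumℤ-sameSign _ n (sign (size α)) (Aset h la) same)) G≡0)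
    where
    n : Vec ℕ m → ℕ
    n mu = bCoeff′ mu * schurCoeff mu α
    same : ∀ {mu} → mu ∈ Aset h la →
      sign (size mu) ℤ.* (+ bCoeff′ mu) ℤ.* (+ schurCoeff mu α) ≡ sign (size α) ℤ.* (+ n mu)
    same {mu} mu∈ with schurCoeff mu α ≟ 0
    -- Only a shape with a pattern of content `α` has the size of `α`; for the other shapes both
    -- sides vanish, whatever their sign.
    ... | yes K≡0 rewrite K≡0 | *-zeroʳ (bCoeff′ mu) =
          trans (ℤ.*-zeroʳ (sign (size mu) ℤ.* (+ bCoeff′ mu))) (sym (ℤ.*-zeroʳ (sign (size α))))
    ... | no K≢0 = trans (ℤ.*-assoc (sign (size mu)) _ _)
          (cong₂ ℤ._*_ (cong sign (trans (size≡∑ mu) (trans (sym size-content) (sym (size≡∑ α)))))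
            (sym (ℤ.pos-* (bCoeff′ mu) (schurCoeff mu α))))
      where open GelfandTsetlin (schurCoeff⇒pattern α mu∈ K≢0)
  ... | inj₁ sign≡0 = contradiction (ℤ.i^n≡0⇒i≡0 -1ℤ (size α ∸ size la) sign≡0) λ ()
  -- A vanishing sum of natural numbers has a vanishing summand at `mu`, but neither of its factors
  -- is zero.
  ... | inj₂ sum≡0 = [ bCoeff≢0 h 1≤h la mu mu↓ box , schurCoeff≢0⁺ mu α (pattern⇒tableau mu↓ P) ]′
    (m*n≡0⇒m≡0∨n≡0 (bCoeff′ mu) (n≤0⇒n≡0 (subst (bCoeff′ mu * schurCoeff mu α ≤_) (ℤ.+-injective sum≡0)
      (∈⇒≤sum (λ mu → bCoeff′ mu * schurCoeff mu α) (Aset⁺ h la 1≤h mu mu↓ box)))))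

-- Linear functionals on Newton polytopes

-- The embedding of the integers normalises its fractions, so its laws are checked on unnormalised
-- rationals with denominator 1.
toℚᵘ-ℤtoℚ : ∀ z → ℚ.toℚᵘ (ℤtoℚ z) ℚᵘ.≃ mkℚᵘ z 0
toℚᵘ-ℤtoℚ z = ℚ.toℚᵘ-fromℚᵘ (mkℚᵘ z 0)

ℤtoℚ-+ : ∀ a b → ℤtoℚ (a ℤ.+ b) ≡ ℤtoℚ a ℚ.+ ℤtoℚ b
ℤtoℚ-+ a b = ℚ.toℚᵘ-injective (begin
  ℚ.toℚᵘ (ℤtoℚ (a ℤ.+ b))                     ≈⟨ toℚᵘ-ℤtoℚ (a ℤ.+ b) ⟩
  mkℚᵘ (a ℤ.+ b) 0                            ≈⟨ *≡* (cong (ℤ._* + 1) (sym (cong₂ ℤ._+_ (ℤ.*-identityʳ a) (ℤ.*-identityʳ b)))) ⟩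
  mkℚᵘ a 0 ℚᵘ.+ mkℚᵘ b 0                      ≈⟨ ℚᵘ.+-cong (ℚᵘ.≃-sym (toℚᵘ-ℤtoℚ a)) (ℚᵘ.≃-sym (toℚᵘ-ℤtoℚ b)) ⟩
  ℚ.toℚᵘ (ℤtoℚ a) ℚᵘ.+ ℚ.toℚᵘ (ℤtoℚ b)        ≈⟨ ℚᵘ.≃-sym (ℚ.toℚᵘ-homo-+ (ℤtoℚ a) (ℤtoℚ b)) ⟩
  ℚ.toℚᵘ (ℤtoℚ a ℚ.+ ℤtoℚ b)                  ∎)
  where open ≃-Reasoning ℚᵘ.≃-setoid

ℤtoℚ-* : ∀ a b → ℤtoℚ (a ℤ.* b) ≡ ℤtoℚ a ℚ.* ℤtoℚ b
ℤtoℚ-* a b = ℚ.toℚᵘ-injective (begin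
  ℚ.toℚᵘ (ℤtoℚ (a ℤ.* b))                     ≈⟨ toℚᵘ-ℤtoℚ (a ℤ.* b) ⟩
  mkℚᵘ a 0 ℚᵘ.* mkℚᵘ b 0                      ≈⟨ ℚᵘ.*-cong (ℚᵘ.≃-sym (toℚᵘ-ℤtoℚ a)) (ℚᵘ.≃-sym (toℚᵘ-ℤtoℚ b)) ⟩
  ℚ.toℚᵘ (ℤtoℚ a) ℚᵘ.* ℚ.toℚᵘ (ℤtoℚ b)        ≈⟨ ℚᵘ.≃-sym (ℚ.toℚᵘ-homo-* (ℤtoℚ a) (ℤtoℚ b)) ⟩
  ℚ.toℚᵘ (ℤtoℚ a ℚ.* ℤtoℚ b)                  ∎)
  where open ≃-Reasoning ℚᵘ.≃-setoid

ℤtoℚ-mono-≤ : ∀ {a b} → a ℤ.≤ b → ℤtoℚ a ℚ.≤ ℤtoℚ b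
ℤtoℚ-mono-≤ {a} {b} a≤b = ℚ.toℚᵘ-cancel-≤
  (ℚᵘ.≤-respˡ-≃ (ℚᵘ.≃-sym (toℚᵘ-ℤtoℚ a)) (ℚᵘ.≤-respʳ-≃ (ℚᵘ.≃-sym (toℚᵘ-ℤtoℚ b))
    (*≤* (ℤ.*-monoʳ-≤-nonNeg (+ 1) a≤b))))

ℤtoℚ-cancel-≤ : ∀ {a b} → ℤtoℚ a ℚ.≤ ℤtoℚ b → a ℤ.≤ b
ℤtoℚ-cancel-≤ {a} {b} le with ℚᵘ.≤-respˡ-≃ (toℚᵘ-ℤtoℚ a) (ℚᵘ.≤-respʳ-≃ (toℚᵘ-ℤtoℚ b) (ℚ.toℚᵘ-mono-≤ le))
... | *≤* a≤b = subst₂ ℤ._≤_ (ℤ.*-identityʳ a) (ℤ.*-identityʳ b) a≤b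

-- Integer coefficients admit negated functionals, through which lower bounds are obtained from
-- upper ones.
dotℤ : ∀ {m} → (ℕ → ℤ) → Vec ℤ m → ℤ
dotℤ ℓ [] = + 0
dotℤ ℓ (a ∷ v) = ℓ 0 ℤ.* a ℤ.+ dotℤ (ℓ ∘ suc) v

dotℚ : ∀ {m} → (ℕ → ℤ) → Vec ℚ m → ℚ
dotℚ ℓ [] = 0ℚ
dotℚ ℓ (a ∷ v) = ℤtoℚ (ℓ 0) ℚ.* a ℚ.+ dotℚ (ℓ ∘ suc) v

dotℚ-ℤtoℚ : ∀ {m} ℓ (v : Vec ℤ m) → dotℚ ℓ (Vec.map ℤtoℚ v) ≡ ℤtoℚ (dotℤ ℓ v)
dotℚ-ℤtoℚ ℓ [] = refl
dotℚ-ℤtoℚ ℓ (a ∷ v) = trans (cong₂ ℚ._+_ (sym (ℤtoℚ-* (ℓ 0) a)) (dotℚ-ℤtoℚ (ℓ ∘ suc) v))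
  (sym (ℤtoℚ-+ (ℓ 0 ℤ.* a) _))

dotℚ-0 : ∀ m ℓ → dotℚ ℓ (zeroVec {m}) ≡ 0ℚ
dotℚ-0 zero ℓ = refl
dotℚ-0 (suc m) ℓ = cong₂ ℚ._+_ (ℚ.*-zeroʳ (ℤtoℚ (ℓ 0))) (dotℚ-0 m (ℓ ∘ suc))

dotℚ-+ : ∀ {m} ℓ (u v : Vec ℚ m) → dotℚ ℓ (Vec.zipWith ℚ._+_ u v) ≡ dotℚ ℓ u ℚ.+ dotℚ ℓ v
dotℚ-+ ℓ [] [] = refl
dotℚ-+ ℓ (a ∷ u) (b ∷ v) = trans
  (cong₂ ℚ._+_ (ℚ.*-distribˡ-+ (ℤtoℚ (ℓ 0)) a b) (dotℚ-+ (ℓ ∘ suc) u v))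
  (CommutativeSemigroup.interchange (CommutativeMonoid.commutativeSemigroup ℚ.+-0-commutativeMonoid)
    (ℤtoℚ (ℓ 0) ℚ.* a) (ℤtoℚ (ℓ 0) ℚ.* b) _ _)

dotℚ-* : ∀ {m} ℓ c (v : Vec ℚ m) → dotℚ ℓ (Vec.map (c ℚ.*_) v) ≡ c ℚ.* dotℚ ℓ v
dotℚ-* ℓ c [] = sym (ℚ.*-zeroʳ c)
dotℚ-* ℓ c (a ∷ v) = trans
  (cong₂ ℚ._+_ (trans (sym (ℚ.*-assoc l c a)) (trans (cong (ℚ._* a) (ℚ.*-comm l c)) (ℚ.*-assoc c l a)))
    (dotℚ-* (ℓ ∘ suc) c v))
  (sym (ℚ.*-distribˡ-+ c _ _))
  where l = ℤtoℚ (ℓ 0)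

-- A bound on the exponents passes to convex combinations. The induction allows any total weight and
-- multiplies `b` by it; that the total is 1 enters only at the end.
newt-bound : ∀ {m} (f : Vec ℕ m → ℤ) ℓ b → (∀ α → f α ≢ + 0 → dotℤ ℓ (Vec.map +_ α) ℤ.≤ b) →
  ∀ {q} → Newt f q → dotℚ ℓ q ℚ.≤ ℤtoℚ b
newt-bound {m} f ℓ b bound (ws , all , total , refl) =
  subst (_ ℚ.≤_) (trans (cong (ℚ._* ℤtoℚ b) total) (ℚ.*-identityˡ _)) (go ws all)
  where
  point : List (ℚ × Vec ℕ m) → Vec ℚ m
  point = foldr (λ wα acc → Vec.zipWith ℚ._+_ (Vec.map (λ a → proj₁ wα ℚ.* ℕtoℚ a) (proj₂ wα)) acc) zeroVec
  map-∘ : ∀ {k} w (α : Vec ℕ k) → Vec.map (λ a → w ℚ.* ℕtoℚ a) α ≡ Vec.map (w ℚ.*_) (Vec.map ℤtoℚ (Vec.map +_ α))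
  map-∘ w [] = refl
  map-∘ w (a ∷ α) = cong (_ ∷_) (map-∘ w α)
  go : ∀ ws → All (λ wα → (0ℚ ℚ.≤ proj₁ wα) × (f (proj₂ wα) ≢ + 0)) ws →
    dotℚ ℓ (point ws) ℚ.≤ foldr ℚ._+_ 0ℚ (map proj₁ ws) ℚ.* ℤtoℚ b
  go [] [] = ℚ.≤-reflexive (trans (dotℚ-0 m ℓ) (sym (ℚ.*-zeroˡ (ℤtoℚ b))))
  go ((w , α) ∷ ws) ((0≤w , fα≢0) ∷ all) = subst₂ ℚ._≤_
    (sym (trans (dotℚ-+ ℓ (Vec.map (λ a → w ℚ.* ℕtoℚ a) α) (point ws)) (cong (ℚ._+ dotℚ ℓ (point ws))
      (trans (cong (dotℚ ℓ) (map-∘ w α)) (trans (dotℚ-* ℓ w (Vec.map ℤtoℚ (Vec.map +_ α)))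
        (cong (w ℚ.*_) (dotℚ-ℤtoℚ ℓ (Vec.map +_ α))))))))
    (sym (ℚ.*-distribʳ-+ (ℤtoℚ b) w _))
    (ℚ.+-mono-≤ (ℚ.*-monoˡ-≤-nonNeg w {{ℚ.nonNegative 0≤w}} (ℤtoℚ-mono-≤ (bound α fα≢0))) (go ws all))

dilate-bound : ∀ {m} (f : Vec ℕ m → ℤ) ℓ b → (∀ α → f α ≢ + 0 → dotℤ ℓ (Vec.map +_ α) ℤ.≤ b) →
  ∀ t p → InDilate (Newt f) t (Vec.map ℤtoℚ p) → dotℤ ℓ p ℤ.≤ + t ℤ.* b
dilate-bound f ℓ b bound t p (q , q∈ , p≡tq) = ℤtoℚ-cancel-≤ (subst₂ ℚ._≤_
  (trans (sym (dotℚ-* ℓ (ℕtoℚ t) q)) (trans (cong (dotℚ ℓ) (sym p≡tq)) (dotℚ-ℤtoℚ ℓ p)))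
  (sym (ℤtoℚ-* (+ t) b))
  (ℚ.*-monoˡ-≤-nonNeg (ℕtoℚ t) {{ℚ.nonNegative (ℤtoℚ-mono-≤ {+ 0} {+ t} (ℤ.+≤+ ℕ.z≤n))}} (newt-bound f ℓ b bound q∈)))

indicator : (ℕ → Bool) → ℕ → ℤ
indicator I i = + 𝟙 (I i)

dotℤ-neg : ∀ {m} ℓ (v : Vec ℤ m) → dotℤ (ℤ.-_ ∘ ℓ) v ≡ ℤ.- dotℤ ℓ v
dotℤ-neg ℓ [] = refl
dotℤ-neg ℓ (a ∷ v) = trans (cong₂ ℤ._+_ (sym (ℤ.neg-distribˡ-* (ℓ 0) a)) (dotℤ-neg (ℓ ∘ suc) v))
  (sym (ℤ.neg-distrib-+ (ℓ 0 ℤ.* a) _))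

dotℤ-indicator : ∀ {m} I (α : Vec ℕ m) → dotℤ (indicator I) (Vec.map +_ α) ≡ + weight I (at α) m
dotℤ-indicator I [] = refl
dotℤ-indicator {suc m} I (a ∷ α) = trans
  (cong₂ ℤ._+_ (sym (ℤ.pos-* (𝟙 (I 0)) a)) (dotℤ-indicator (I ∘ suc) α))
  (trans (sym (ℤ.pos-+ (𝟙 (I 0) ℕ.* a) _)) (cong +_ (sym (∑-head (λ i → 𝟙 (I i) ℕ.* at (a ∷ α) i) m))))

dotℤ-none : ∀ {m} (v : Vec ℤ m) → dotℤ (λ _ → + 0) v ≡ + 0
dotℤ-none [] = refl
dotℤ-none (a ∷ v) = trans (ℤ.+-identityˡ _) (dotℤ-none v)

dotℤ-coordinate : ∀ {m} (v : Vec ℤ m) i → dotℤ (indicator (_≡ᵇ toℕ i)) v ≡ lookup v i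
dotℤ-coordinate (a ∷ v) Fin.zero = trans (cong₂ ℤ._+_ (ℤ.*-identityˡ a) (dotℤ-none v)) (ℤ.+-identityʳ a)
dotℤ-coordinate (a ∷ v) (Fin.suc i) = trans (ℤ.+-identityˡ _) (dotℤ-coordinate v i)

nonneg⇒ℕ : ∀ {m} (p : Vec ℤ m) → (∀ i → + 0 ℤ.≤ lookup p i) → Vec.map +_ (Vec.map ℤ.∣_∣ p) ≡ p
nonneg⇒ℕ [] _ = refl
nonneg⇒ℕ (a ∷ p) nonneg = cong₂ _∷_ (ℤ.0≤i⇒+∣i∣≡i (nonneg Fin.zero)) (nonneg⇒ℕ p (nonneg ∘ Fin.suc))

module Dilate {m : ℕ} (f : Vec ℕ m → ℤ) (t : ℕ) where

  dilate-weight-upper : ∀ I {B} → (∀ α → f α ≢ + 0 → weight I (at α) m ℕ.≤ B) →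
    ∀ p → InDilate (Newt f) t (Vec.map ℤtoℚ (Vec.map +_ p)) → weight I (at p) m ℕ.≤ t ℕ.* B
  dilate-weight-upper I {B} bound p p∈ = ℤ.drop‿+≤+ (subst₂ ℤ._≤_ (dotℤ-indicator I p) (sym (ℤ.pos-* t B))
    (dilate-bound f (indicator I) (+ B)
      (λ α fα≢0 → subst (ℤ._≤ + B) (sym (dotℤ-indicator I α)) (ℤ.+≤+ (bound α fα≢0))) t (Vec.map +_ p) p∈))

  -- The upper bound for the negated functional. The point is an integer vector here because its
  -- non-negativity is itself deduced from this lemma.
  dilate-dot-lower : ∀ I {D} → (∀ α → f α ≢ + 0 → D ℕ.≤ weight I (at α) m) →
    ∀ p → InDilate (Newt f) t (Vec.map ℤtoℚ p) → + (t ℕ.* D) ℤ.≤ dotℤ (indicator I) p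
  dilate-dot-lower I {D} bound p p∈ = ℤ.neg-cancel-≤ (subst₂ ℤ._≤_ (dotℤ-neg (indicator I) p)
    (trans (sym (ℤ.neg-distribʳ-* (+ t) (+ D))) (cong ℤ.-_ (sym (ℤ.pos-* t D))))
    (dilate-bound f (ℤ.-_ ∘ indicator I) (ℤ.- + D)
      (λ α fα≢0 → subst (ℤ._≤ ℤ.- + D) (sym (trans (dotℤ-neg (indicator I) (Vec.map +_ α)) (cong ℤ.-_ (dotℤ-indicator I α))))
        (ℤ.neg-mono-≤ (ℤ.+≤+ (bound α fα≢0)))) t p p∈))

  dilate-weight-lower : ∀ I {D} → (∀ α → f α ≢ + 0 → D ℕ.≤ weight I (at α) m) →
    ∀ p → InDilate (Newt f) t (Vec.map ℤtoℚ (Vec.map +_ p)) → t ℕ.* D ℕ.≤ weight I (at p) m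
  dilate-weight-lower I bound p p∈ =
    ℤ.drop‿+≤+ (subst (_ ℤ.≤_) (dotℤ-indicator I p) (dilate-dot-lower I bound (Vec.map +_ p) p∈))

  -- Singleton index sets with the trivial lower bound 0 on exponents.
  dilate-nonneg : ∀ p → InDilate (Newt f) t (Vec.map ℤtoℚ p) → ∀ i → + 0 ℤ.≤ lookup p i
  dilate-nonneg p p∈ i = subst₂ ℤ._≤_ (cong +_ (ℕ.*-zeroʳ t)) (dotℤ-coordinate p i)
    (dilate-dot-lower (_≡ᵇ toℕ i) (λ _ _ → ℕ.z≤n) p p∈)

∈Newt : ∀ {m} (f : Vec ℕ m → ℤ) α → f α ≢ + 0 → Newt f (Vec.map ℤtoℚ (Vec.map +_ α))
∈Newt f α fα≢0 = (1ℚ , α) ∷ [] , (ℚ.nonNegative⁻¹ 1ℚ , fα≢0) ∷ [] , refl , point α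
  where
  point : ∀ {k} (α : Vec ℕ k) → Vec.map ℤtoℚ (Vec.map +_ α) ≡
    Vec.zipWith ℚ._+_ (Vec.map (λ a → 1ℚ ℚ.* ℕtoℚ a) α) zeroVec
  point [] = refl
  point (a ∷ α) = cong₂ _∷_ (sym (trans (ℚ.+-identityʳ _) (ℚ.*-identityˡ (ℕtoℚ a)))) (point α)

-- Decomposition

-- The inequalities below say that p meets Rado's condition for the greedy partition between lo and hi.
dominating-pattern : ∀ m {lo hi p} → Antitone lo → Antitone hi → (∀ {j} → j < m → lo j ≤ hi j) →
  (∀ I → weight I p m ≤ ∑ hi (card I m)) →
  (∀ I → ∑ lo m ≤ weight (not ∘ I) p m + ∑ lo (card I m)) →
  Σ (Greedy lo hi m (∑ p m)) λ G → GelfandTsetlin m (Greedy.ν G) p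
dominating-pattern m {lo} {hi} {p} lo↓ hi↓ lo≤hi p≤hi lo≤p =
  G , kostka-positive m G.antitone G.vanish p≤ν (sym G.total)
  where
  all≡∑ : weight (λ _ → true) p m ≡ ∑ p m
  all≡∑ = ∑-cong m (λ i _ → *-identityˡ (p i))
  G : Greedy lo hi m (∑ p m)
  G = greedy m lo↓ hi↓ lo≤hi
    -- The empty index set gives the lower bound on the size of `p`, the full one the upper bound.
    (subst (∑ lo m ≤_) (trans (cong₂ _+_ all≡∑ (cong (∑ lo) (∑-0 m))) (+-identityʳ _)) (lo≤p (λ _ → false)))
    (subst₂ _≤_ all≡∑ (cong (∑ hi) (∑-1 m)) (p≤hi (λ _ → true)))
  module G = Greedy G
  p≤ν : ∀ I → weight I p m ≤ ∑ G.ν (card I m)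
  p≤ν I with G.prefix (card≤ I m)
  ... | inj₁ eq = subst (weight I p m ≤_) (sym eq) (p≤hi I)
  ... | inj₂ eq = +-cancelʳ-≤ (∑ lo m) _ _ (begin
    W + ∑ lo m                     ≤⟨ +-monoʳ-≤ W (lo≤p I) ⟩
    W + (W′ + ∑ lo (card I m))     ≡⟨ sym (+-assoc W W′ _) ⟩
    (W + W′) + ∑ lo (card I m)     ≡⟨ cong (_+ ∑ lo (card I m)) (weight-not I p m) ⟩
    ∑ p m + ∑ lo (card I m)        ≡⟨ sym eq ⟩
    ∑ G.ν (card I m) + ∑ lo m      ∎)
    where
    open ≤-Reasoning
    W W′ : ℕ
    W = weight I p m
    W′ = weight (not ∘ I) p m

pattern-cong : ∀ {m μ μ′ α α′} → (∀ j → μ j ≡ μ′ j) → (∀ {i} → i < m → α i ≡ α′ i) →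
  GelfandTsetlin m μ α → GelfandTsetlin m μ′ α′
pattern-cong {m} μ≡ α≡ P = record
  { x = x
  ; zero-row = zero-row
  ; grow = grow
  ; interlace = interlace
  ; top = λ j → trans (top j) (μ≡ j)
  ; content-∑ = λ {i} i<m → trans (content-∑ i<m) (cong (_+ ∑ (x i) m) (α≡ i<m)) }
  where open GelfandTsetlin P

at-antitone : ∀ {m} (v : Vec ℕ m) → IsPartition v → Antitone (at v)
at-antitone [] _ j = z≤n
at-antitone (a ∷ []) _ j = z≤n
at-antitone (a ∷ b ∷ v) dec zero = dec Fin.zero (Fin.suc Fin.zero) z≤n
at-antitone (a ∷ b ∷ v) dec (suc j) = at-antitone (b ∷ v) (λ i j i≤j → dec (Fin.suc i) (Fin.suc j) (s≤s i≤j)) j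

at-mono : ∀ {m} (u v : Vec ℕ m) → (∀ {j} → j < m → at u j ≤ at v j) → ∀ j → at u j ≤ at v j
at-mono {m} u v u≤v j with j <? m
... | yes j<m = u≤v j<m
... | no j≮m = subst (_≤ at v j) (sym (at-≥ u (≮⇒≥ j≮m))) z≤n

tabulate-at : ∀ {m} (v : Vec ℕ m) → tabulate (at v ∘ toℕ) ≡ v
tabulate-at [] = refl
tabulate-at (a ∷ v) = cong (a ∷_) (tabulate-at v)

fromℕ : ∀ m → (ℕ → ℕ) → Vec ℤ m
fromℕ m f = Vec.map +_ (tabulate (f ∘ toℕ))

fromℕ-cong : ∀ m {f g} → (∀ {i} → i < m → f i ≡ g i) → fromℕ m f ≡ fromℕ m g
fromℕ-cong zero eq = refl
fromℕ-cong (suc m) eq = cong₂ _∷_ (cong +_ (eq z<s)) (fromℕ-cong m (eq ∘ s<s))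

fromℕ-0 : ∀ m → replicate m (+ 0) ≡ fromℕ m (λ _ → 0)
fromℕ-0 zero = refl
fromℕ-0 (suc m) = cong (+ 0 ∷_) (fromℕ-0 m)

fromℕ-+ : ∀ m f g → Vec.zipWith ℤ._+_ (fromℕ m f) (fromℕ m g) ≡ fromℕ m (λ i → g i + f i)
fromℕ-+ zero f g = refl
fromℕ-+ (suc m) f g = cong₂ _∷_ (cong +_ (+-comm (f 0) (g 0))) (fromℕ-+ m (f ∘ suc) (g ∘ suc))

-- The last vector comes first, in step with the recursion of `∑`.
stack : ∀ m (v : ℕ → ℕ → ℕ) n → Vec (Vec ℤ m) n
stack m v zero = []
stack m v (suc n) = fromℕ m (v n) ∷ stack m v n

sum-stack : ∀ m v n → sumVecsℤ (stack m v n) ≡ fromℕ m (λ k → ∑ (λ i → v i k) n)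
sum-stack m v zero = fromℕ-0 m
sum-stack m v (suc n) = trans (cong (Vec.zipWith ℤ._+_ (fromℕ m (v n))) (sum-stack m v n))
  (fromℕ-+ m (v n) (λ k → ∑ (λ i → v i k) n))

All-stack : ∀ {m v} {Q : Vec ℤ m → Set} n → (∀ {i} → i < n → Q (fromℕ m (v i))) → VAll.All Q (stack m v n)
All-stack zero _ = []
All-stack (suc n) all = all ≤-refl ∷ All-stack n (all ∘ m<n⇒m<1+n)

module _ {m : ℕ} (h : ℕ) (1≤h : 1 ≤ h) (la : Vec ℕ m) (la↓ : Antitone (at la)) where

  open Support h 1≤h la

  -- The largest partition in the box.
  u : ℕ → ℕ
  u = minUpTo (λ i → at la i + h * i)

  u↓ : Antitone u
  u↓ = minUpTo-antitone _

  la≤u : ∀ j → at la j ≤ u j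
  la≤u j = ≤+minUpTo 0 j (λ {i} i≤j → m≤n⇒m≤n+o (h * i) (antitone-≤ la↓ (≤⇒≤′ i≤j)))

  -- For `i ≤ j` one has `mu j ≤ mu i ≤ la i + h * i`, and `u j` is the minimum of these bounds.
  mu≤u : ∀ {mu} → Antitone mu → Boxed h (at la) mu m → ∀ {j} → j < m → mu j ≤ u j
  mu≤u mu↓ box {j} j<m = ≤+minUpTo 0 j (λ i≤j →
    ≤-trans (antitone-≤ mu↓ (≤⇒≤′ i≤j)) (proj₂ (box (≤-<-trans i≤j j<m))))

  pattern-upper : ∀ {mu α} → Antitone mu → Boxed h (at la) mu m → GelfandTsetlin m mu α →
    ∀ I → weight I α m ≤ ∑ u (card I m)
  pattern-upper mu↓ box P I = ≤-trans (GelfandTsetlin.weight≤shape P I)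
    (∑-mono (card I m) (λ j j<k → mu≤u mu↓ box (<-≤-trans j<k (card≤ I m))))

  -- The coordinates in `I` take at most the first `card I m` rows of `mu`, so the complement
  -- carries at least the remaining rows, and these contain those of `la`.
  pattern-lower : ∀ {mu α} → (∀ j → at la j ≤ mu j) → GelfandTsetlin m mu α →
    ∀ I → ∑ (at la) m ∸ ∑ (at la) (card I m) ≤ weight (not ∘ I) α m
  pattern-lower {mu} {α} la≤mu P I = m≤n+o⇒m∸n≤o L C (+-cancelˡ-≤ W L (C + W′) (begin
    W + L                     ≤⟨ +-monoˡ-≤ L (weight≤shape I) ⟩
    ∑ mu (card I m) + L       ≤⟨ ∑-segment-mono (at la) mu la≤mu (≤⇒≤′ (card≤ I m)) ⟩
    ∑ mu m + C                ≡⟨ cong (_+ C) (sym size-content) ⟩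
    ∑ α m + C                 ≡⟨ cong (_+ C) (sym (weight-not I α m)) ⟩
    (W + W′) + C              ≡⟨ +-assoc W W′ C ⟩
    W + (W′ + C)              ≡⟨ cong (_+_ W) (+-comm W′ C) ⟩
    W + (C + W′)              ∎))
    where
    open ≤-Reasoning
    open GelfandTsetlin P
    L C W W′ : ℕ
    L = ∑ (at la) m
    C = ∑ (at la) (card I m)
    W = weight I α m
    W′ = weight (not ∘ I) α m

  support-upper : ∀ I α → Gcoeff h la α ≢ + 0 → weight I (at α) m ≤ ∑ u (card I m)
  support-upper I α G≢0 = let _ , mu↓ , box , P = Gcoeff≢0⁻ α G≢0 in pattern-upper mu↓ box P I

  support-lower : ∀ I α → Gcoeff h la α ≢ + 0 →
    ∑ (at la) m ∸ ∑ (at la) (card I m) ≤ weight (not ∘ I) (at α) m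
  support-lower I α G≢0 = let mu , _ , box , P = Gcoeff≢0⁻ α G≢0 in
    pattern-lower (at-mono la mu (proj₁ ∘ box)) P I

  -- Rounding turns `t * la j ≤ ν j ≤ t * u j` into `la j ≤ φ i (ν j) ≤ u j`, so every part is a
  -- pattern whose top row is a partition in the box.
  split-support : ∀ t .{{_ : NonZero t}} {ν p} → Antitone ν → (∀ {j} → m ≤ j → ν j ≡ 0) →
    (∀ {j} → j < m → t * at la j ≤ ν j) → (∀ {j} → j < m → ν j ≤ t * u j) → GelfandTsetlin m ν p →
    ∃ λ (v : ℕ → ℕ → ℕ) →
      (∀ {i} → i < t → Gcoeff h la (tabulate (v i ∘ toℕ)) ≢ + 0) ×
      (∀ {k} → k < m → ∑ (λ i → v i k) t ≡ p k)
  split-support t {ν} {p} ν↓ vanish lower upper P = part-content , part-support , ∑-part-content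
    where
    open Split P t
    part-support : ∀ {i} → i < t → Gcoeff h la (tabulate (part-content i ∘ toℕ)) ≢ + 0
    part-support {i} i<t = Gcoeff≢0⁺ mu _
      (λ j → subst₂ _≤_ (sym (at-mu (suc j))) (sym (at-mu j)) (φ-mono i (ν↓ j)))
      (λ {j} j<m → subst (λ a → at la j ≤ a × a ≤ at la j + h * j) (sym (at-mu j))
        (φ-lower i (lower j<m) , ≤-trans (φ-upper i<t (upper j<m)) (minUpTo≤ _ j)))
      (pattern-cong (sym ∘ at-mu) (λ k<m → sym (at-tabulate m (part-content i) k<m)) (part i<t))
      where
      mu = tabulate (φ i ∘ ν ∘ toℕ)
      at-mu : ∀ j → at mu j ≡ φ i (ν j)
      at-mu j with j <? m
      ... | yes j<m = at-tabulate m (φ i ∘ ν) j<m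
      -- Beyond `m` both sides are 0: the left by padding, the right because `i < t` rounds 0 to 0.
      ... | no j≮m = trans (at-≥ mu (≮⇒≥ j≮m))
            (sym (trans (cong (φ i) (vanish (≮⇒≥ j≮m))) (φ-zero i<t)))

  module _ (t : ℕ) (p : Vec ℕ m)
    (p∈ : InDilate (Newt (Gcoeff h la)) t (Vec.map ℤtoℚ (Vec.map +_ p))) where

    open Dilate (Gcoeff h la) t

    lo hi : ℕ → ℕ
    lo j = t * at la j
    hi j = t * u j

    weight≤hi : ∀ I → weight I (at p) m ≤ ∑ hi (card I m)
    weight≤hi I = subst (weight I (at p) m ≤_) (sym (∑-* t u (card I m)))
      (dilate-weight-upper I (support-upper I) p p∈)

    lo≤weight : ∀ I → ∑ lo m ≤ weight (not ∘ I) (at p) m + ∑ lo (card I m)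
    lo≤weight I = subst₂ _≤_
      -- The truncated difference is exact because `C ≤ L`.
      (trans (sym (*-distribˡ-+ t (L ∸ C) C)) (trans (cong (t *_) (m∸n+n≡m C≤L)) (sym (∑-* t (at la) m))))
      (cong (_+_ W′) (sym (∑-* t (at la) (card I m))))
      (+-monoˡ-≤ (t * C) (dilate-weight-lower (not ∘ I) (support-lower I) p p∈))
      where
      L C W′ : ℕ
      L = ∑ (at la) m
      C = ∑ (at la) (card I m)
      W′ = weight (not ∘ I) (at p) m
      C≤L : C ≤ L
      C≤L = ∑-monoʳ (at la) (≤⇒≤′ (card≤ I m))

    decomposition : .{{_ : NonZero t}} → Σ (Vec (Vec ℤ m) t) λ vs →
      VAll.All (λ v → Newt (Gcoeff h la) (Vec.map ℤtoℚ v)) vs × sumVecsℤ vs ≡ Vec.map +_ p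
    decomposition =
      let G , P = dominating-pattern m (λ j → *-monoʳ-≤ t (la↓ j)) (λ j → *-monoʳ-≤ t (u↓ j))
                    (λ {j} _ → *-monoʳ-≤ t (la≤u j)) weight≤hi lo≤weight
          open Greedy G
          v , v∈ , ∑v = split-support t antitone vanish lower upper P
      in stack m v t ,
         All-stack t (λ {i} i<t → ∈Newt (Gcoeff h la) (tabulate (v i ∘ toℕ)) (v∈ i<t)) ,
         trans (sum-stack m v t) (trans (fromℕ-cong m ∑v) (cong (λ q → Vec.map +_ q) (tabulate-at p)))

theorem3p17 : (m h : ℕ) → 1 ≤ m → 1 ≤ h → (la : Vec ℕ m) → IsPartition la →
    HasIDP (Newt (Gcoeff h la))
theorem3p17 m h _ 1≤h la la↓ t 1≤t p p∈ = subst
  (λ q → InDilate (Newt (Gcoeff h la)) t (Vec.map ℤtoℚ q) → Σ (Vec (Vec ℤ m) t) λ vs →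
    VAll.All (λ v → Newt (Gcoeff h la) (Vec.map ℤtoℚ v)) vs × sumVecsℤ vs ≡ q)
  -- Points of the dilate have non-negative coordinates, so `p` is the image of a vector of natural
  -- numbers; membership and conclusion are transported together.
  (nonneg⇒ℕ p (Dilate.dilate-nonneg (Gcoeff h la) t p p∈))
  (λ q∈ → decomposition h 1≤h la (at-antitone la la↓) t (Vec.map ℤ.∣_∣ p) q∈ {{>-nonZero 1≤t}})
  p∈
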